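{- Let $q$ be a complex number with $|q|<1$ (equivalently, work with formal power series in $q$). Define \[ \mathcal{B}^{(2)}(q) := \sum_{n_2 \geq n_1 \geq 0} \frac{q^{n_2^2+n_1^2}}{(q)_{n_2-n_1}\,(-q)_{n_1}^2}, \qquad \chi(q) := \sum_{n \geq 0} \frac{(-1)^n q^{(n+1)^2}}{(-q)_{2n+1}}, \qquad X(q) := \sum_{n \geq 0} \frac{(-1)^n q^{n^2}}{(-q)_{2n}}. \] Then \[ \mathcal{B}^{(2)}(q) + \frac{2}{(q^2, q^3; q^5)_{\infty}}\, \chi(q) - \frac{2}{(q, q^4; q^5)_{\infty}}\, X(q) = -\frac{(q)_{\infty}}{(-q)_{\infty}^2}. \]
   Context: Standard $q$-Pochhammer notation: for $n \in \mathbb{N}\cup\{\infty\}$, $(a_1,\dots,a_j;q)_n := \prod_{k=1}^{n}(1-a_1q^{k-1})\cdots(1-a_jq^{k-1})$, and $(a)_n := (a;q)_n$ (so $(q)_n=(q;q)_n$, $(-q)_n=(-q;q)_n$). The functions $\chi(q)$ and $X(q)$ are Ramanujan's tenth order mock theta functions. -}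

module Defs where

open import Data.Nat as ℕ using (ℕ; zero; suc; _∸_; _≟_)
open import Data.Integer as ℤ using (ℤ; +_; -_; _+_; _*_; _-_)
open import Data.List using (List; []; _∷_)
open import Relation.Nullary using (yes; no)

-- Formal power series in q with integer coefficients, represented by
-- their coefficient function: f N = coefficient of q^N.

Series : Set
Series = ℕ → ℤ

sumTo : ℕ → (ℕ → ℤ) → ℤ
sumTo zero    h = h zero
sumTo (suc n) h = sumTo n h + h (suc n)

0s : Series
0s _ = + 0

1s : Series
1s zero    = + 1
1s (suc _) = + 0

qpow : ℕ → Series
qpow m N with m ≟ N
... | yes _ = + 1
... | no  _ = + 0

qs : Series
qs = qpow 1

infixl 6 _⊕_ _⊖_
infixl 7 _⊛_

_⊕_ : Series → Series → Series
(f ⊕ g) N = f N + g N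

⊝_ : Series → Series
(⊝ f) N = - f N

_⊖_ : Series → Series → Series
(f ⊖ g) N = f N - g N

_·_ : ℤ → Series → Series
(c · f) N = c * f N

_⊛_ : Series → Series → Series
(f ⊛ g) N = sumTo N (λ i → f i * g (N ∸ i))

-- Multiplicative inverse of a series with constant term 1
-- (all series inverted below have constant term 1).
-- g 0 = 1,  g N = - Σ_{k=1}^{N} f k * g (N - k).
private
  -- given gs = [g_N , … , g_0], compute Σ_{i=0}^{N} f (i+1) * g_{N-i}
  conv : Series → ℕ → List ℤ → ℤ
  conv f i []       = + 0
  conv f i (x ∷ xs) = f (suc i) * x + conv f (suc i) xs

  invUpTo : Series → ℕ → List ℤ
  invUpTo f zero    = + 1 ∷ []
  invUpTo f (suc N) = let gs = invUpTo f N in (- conv f 0 gs) ∷ gs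

inv : Series → Series
inv f N with invUpTo f N
... | []    = + 0
... | x ∷ _ = x

prodBelow : ℕ → (ℕ → Series) → Series
prodBelow zero    F = 1s
prodBelow (suc n) F = prodBelow n F ⊛ F n

poch : Series → ℕ → Series
poch a n = prodBelow n (λ k → 1s ⊖ (a ⊛ qpow k))

-- (a;q)_∞ for a with zero constant term: the coefficient of q^N of the
-- infinite product only involves the factors 1 - a q^k with k ≤ N,
-- so it equals the coefficient of q^N of (a;q)_{N+1}.
pochInf : Series → Series
pochInf a N = poch a (suc N) N

-- Formal infinite sum Σ_{n≥0} F n of a family with ord(F n) ≥ n
-- (true for all families summed below): coefficient of q^N only
-- receives contributions from n ≤ N.
sumInf : (ℕ → Series) → Series
sumInf F N = sumTo N (λ n → F n N)

sumSeries : ℕ → (ℕ → Series) → Series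
sumSeries n F N = sumTo n (λ i → F i N)

qPoch : ℕ → Series
qPoch = poch qs

mqPoch : ℕ → Series
mqPoch = poch (⊝ qs)

sgn : ℕ → ℤ
sgn zero    = + 1
sgn (suc n) = - sgn n

B2 : Series
B2 = sumInf (λ n₂ → sumSeries n₂ (λ n₁ →
       qpow (n₂ ℕ.* n₂ ℕ.+ n₁ ℕ.* n₁)
       ⊛ inv (qPoch (n₂ ∸ n₁) ⊛ mqPoch n₁ ⊛ mqPoch n₁)))

χ : Series
χ = sumInf (λ n → sgn n · (qpow (suc n ℕ.* suc n) ⊛ inv (mqPoch (suc (2 ℕ.* n)))))

X : Series
X = sumInf (λ n → sgn n · (qpow (n ℕ.* n) ⊛ inv (mqPoch (2 ℕ.* n))))

-- (a, b; q^5)_∞ with a = q^i, b = q^j : Π_{k≥0} (1 - q^{5k+i})(1 - q^{5k+j})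
-- as a formal series in q; q^5-Pochhammer with zero-constant-term arguments.
poch5 : Series → ℕ → Series
poch5 a n = prodBelow n (λ k → 1s ⊖ (a ⊛ qpow (5 ℕ.* k)))

poch5Inf : Series → Series
poch5Inf a N = poch5 a (suc N) N

G23 : Series
G23 = poch5Inf (qpow 2) ⊛ poch5Inf (qpow 3)

G14 : Series
G14 = poch5Inf (qpow 1) ⊛ poch5Inf (qpow 4)

qInf : Series
qInf = pochInf qs

mqInf : Series
mqInf = pochInf (⊝ qs)

{-# OPTIONS --safe #-}
module Submission where

open import Defs
open import Data.Nat using (ℕ)
open import Data.Integer using (ℤ; +_)
open import Relation.Binary.PropositionalEquality using (_≡_)

open import Algebra.Bundles using (CommutativeRing)
open import Algebra.Properties.CommutativeSemigroup using (interchange)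
import Algebra.Properties.Semiring.Exp
import Algebra.Solver.Ring
open import Algebra.Solver.Ring.AlmostCommutativeRing
  using (fromCommutativeRing; _-Raw-AlmostCommutative⟶_)
open import Algebra.Structures using (IsCommutativeRing)
open import Data.Integer as ℤ using (_+_; _*_; _-_; -_)
import Data.Integer.Properties as ℤₚ
open import Data.Maybe as Maybe using (Maybe)
open import Data.Nat as ℕ using (zero; suc; _∸_; _≤_; _<_; z≤n; s≤s)
import Data.Nat.Properties as ℕₚ
open import Data.Nat.Tactic.RingSolver using (solve-∀)
open import Data.Product using (_,_)
open import Data.Sum using (inj₁; inj₂)
open import Level using (0ℓ)
open import Relation.Binary.PropositionalEquality
  using (_≢_; refl; sym; trans; cong; cong₂; subst; module ≡-Reasoning)
import Relation.Binary.Reasoning.Setoid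
open import Relation.Nullary using (yes; no; contradiction)
open import Relation.Nullary.Decidable using (dec⇒maybe)

-- Put v_k = 1/(-q)_k and G_k = Σ_m q^(m²+km)/(q)_m, so that G_k = G_{k+1} + q^(k+1) G_{k+2} and
-- G_0, G_1 are the two Rogers–Ramanujan sums.  Shift the index of the three q-series by k:
--   X_k = Σ_n (-1)^n q^(n²) v_{2n+k},   χ_k = Σ_n (-1)^n q^((n+1)²) v_{2n+1+k},
--   β_k = Σ_n q^(2n²+2kn) v_n v_{n+k} G_{2n+k},   so that β_0 = B2.
-- From X_k - X_{k+1} = q^k χ_k and χ_{k+1} = v_k - X_k the series Z_k = X_k G_k - q^k χ_k G_{k+1}
-- satisfies Z_k - Z_{k+1} = v_k (G_k - G_{k+1}), while a telescoping sum gives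
-- β_k - β_{k+1} = 2 v_k (G_k - G_{k+1}).  Hence 2 Z_k - β_k does not depend on k.  At k = 0 it is
-- 2 X G_0 - 2 χ G_1 - B2, and for k → ∞ it tends to (Σ_{n ∈ ℤ} (-1)^n q^(n²)) / (-q)_∞, which is
-- (q)_∞ / (-q)_∞² by Gauss.  Both Gauss's identity and the Rogers–Ramanujan identities are
-- obtained from Jacobi's triple product.

-- The ring of formal power series

-- Eliminating `χ` gives `X_(k+2) = X_(k+1) + q^(k+1) X_k - q^(k+1) v_k`, whose homogeneous part is
-- the adjoint of the recurrence of `G`. `Z` is the bilinear concomitant of the two recurrences: for
-- a homogeneous solution it would not depend on `k`, so only the inhomogeneity `v_k` enters
-- `Z_k - Z_(k+1)`. The increments of `β` are twice as large because its telescoping certificate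
-- carries `1 + q^n`, taken at `n = 0`. Everything lives in ℤ[[q]]. A limit in `k` is a congruence
-- modulo a power of `q` that grows with `k`; a quantity independent of `k` is then determined
-- completely. The same principle singles out `G` among the solutions of its recurrence: a solution
-- divisible by `q^k` at each index `k` is zero, so an explicit series with the recurrence and the
-- limit of `(q)_∞ G` must equal it. For want of a second variable, the triple product is taken at
-- `z = q^a` with `0 < a < b`, which keeps all exponents nonnegative.

sum-cong : ∀ N {f g : ℕ → ℤ} → (∀ i → i ≤ N → f i ≡ g i) → sumTo N f ≡ sumTo N g
sum-cong zero    e = e 0 z≤n
sum-cong (suc N) e =
  cong₂ _+_ (sum-cong N (λ i i≤N → e i (ℕₚ.m≤n⇒m≤1+n i≤N))) (e (suc N) ℕₚ.≤-refl)

sum-cong′ : ∀ N {f g : ℕ → ℤ} → (∀ i → f i ≡ g i) → sumTo N f ≡ sumTo N g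
sum-cong′ N e = sum-cong N (λ i _ → e i)

sum-zero : ∀ N {f : ℕ → ℤ} → (∀ i → i ≤ N → f i ≡ + 0) → sumTo N f ≡ + 0
sum-zero zero    e = e 0 z≤n
sum-zero (suc N) e =
  cong₂ _+_ (sum-zero N (λ i i≤N → e i (ℕₚ.m≤n⇒m≤1+n i≤N))) (e (suc N) ℕₚ.≤-refl)

sum-+ : ∀ N f g → sumTo N (λ i → f i + g i) ≡ sumTo N f + sumTo N g
sum-+ zero    f g = refl
sum-+ (suc N) f g = trans (cong (λ x → x + (f (suc N) + g (suc N))) (sum-+ N f g))
  (interchange ℤₚ.+-commutativeSemigroup (sumTo N f) (sumTo N g) (f (suc N)) (g (suc N)))

sum-neg : ∀ N f → sumTo N (λ i → - f i) ≡ - sumTo N f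
sum-neg zero    f = refl
sum-neg (suc N) f = trans (cong (λ x → x + (- f (suc N))) (sum-neg N f))
  (sym (ℤₚ.neg-distrib-+ (sumTo N f) (f (suc N))))

sum-*ˡ : ∀ N c f → sumTo N (λ i → c * f i) ≡ c * sumTo N f
sum-*ˡ zero    c f = refl
sum-*ˡ (suc N) c f = trans (cong (λ x → x + c * f (suc N)) (sum-*ˡ N c f))
  (sym (ℤₚ.*-distribˡ-+ c (sumTo N f) (f (suc N))))

sum-*ʳ : ∀ N c f → sumTo N (λ i → f i * c) ≡ sumTo N f * c
sum-*ʳ N c f = trans (sum-cong′ N (λ i → ℤₚ.*-comm (f i) c))
  (trans (sum-*ˡ N c f) (ℤₚ.*-comm c (sumTo N f)))

sum-shift : ∀ N f → sumTo (suc N) f ≡ f 0 + sumTo N (λ i → f (suc i))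
sum-shift zero    f = refl
sum-shift (suc N) f = trans (cong (λ x → x + f (suc (suc N))) (sum-shift N f))
  (ℤₚ.+-assoc (f 0) (sumTo N (λ i → f (suc i))) (f (suc (suc N))))

sum-reverse : ∀ N h → sumTo N (λ i → h (N ∸ i)) ≡ sumTo N h
sum-reverse zero    h = refl
sum-reverse (suc N) h = trans (sum-shift N (λ i → h (suc N ∸ i)))
  (trans (cong (λ x → h (suc N) + x) (sum-reverse N h)) (ℤₚ.+-comm (h (suc N)) (sumTo N h)))

-- Antidiagonals against rows of one triangle. It gives associativity of the convolution, and later
-- the passage from `n₂`, `n₁` to independent indices in `B2`.
sum-triangle : ∀ N (a : ℕ → ℕ → ℤ) →
  sumTo N (λ i → sumTo i (λ j → a j (i ∸ j))) ≡ sumTo N (λ j → sumTo (N ∸ j) (a j))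
sum-triangle zero    a = refl
sum-triangle (suc N) a = begin
  sumTo N (λ i → sumTo i (λ j → a j (i ∸ j))) +
    (sumTo N (λ j → a j (suc N ∸ j)) + a (suc N) (N ∸ N))
      ≡⟨ cong (λ x → x + (sumTo N (λ j → a j (suc N ∸ j)) + a (suc N) (N ∸ N))) (sum-triangle N a) ⟩
  sumTo N (λ j → sumTo (N ∸ j) (a j)) + (sumTo N (λ j → a j (suc N ∸ j)) + a (suc N) (N ∸ N))
      ≡⟨ ℤₚ.+-assoc (sumTo N (λ j → sumTo (N ∸ j) (a j))) _ _ ⟨
  (sumTo N (λ j → sumTo (N ∸ j) (a j)) + sumTo N (λ j → a j (suc N ∸ j))) + a (suc N) (N ∸ N)
      ≡⟨ cong₂ _+_ (sym (sum-+ N _ _)) (last (N ∸ N) (ℕₚ.n∸n≡0 N)) ⟩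
  sumTo N (λ j → sumTo (N ∸ j) (a j) + a j (suc N ∸ j)) + sumTo (N ∸ N) (a (suc N))
      ≡⟨ cong (λ x → x + sumTo (N ∸ N) (a (suc N))) (sum-cong N step) ⟩
  sumTo N (λ j → sumTo (suc N ∸ j) (a j)) + sumTo (N ∸ N) (a (suc N)) ∎
  where
  open ≡-Reasoning
  last : ∀ m → m ≡ 0 → a (suc N) m ≡ sumTo m (a (suc N))
  last .0 refl = refl
  step : ∀ j → j ≤ N → sumTo (N ∸ j) (a j) + a j (suc N ∸ j) ≡ sumTo (suc N ∸ j) (a j)
  step j j≤N rewrite ℕₚ.+-∸-assoc 1 j≤N = refl

infix 4 _≈_

-- A record instead of a bare pointwise equality, so that `f` and `g` can be inferred from the type
-- in equational reasoning.
record _≈_ (f g : Series) : Set where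
  constructor coeffwise
  field at : ∀ N → f N ≡ g N

open _≈_

≈-refl : ∀ {f} → f ≈ f
≈-refl = coeffwise λ _ → refl

≈-sym : ∀ {f g} → f ≈ g → g ≈ f
≈-sym e = coeffwise λ N → sym (at e N)

≈-trans : ∀ {f g h} → f ≈ g → g ≈ h → f ≈ h
≈-trans e e′ = coeffwise λ N → trans (at e N) (at e′ N)

⊛-comm : ∀ f g → f ⊛ g ≈ g ⊛ f
⊛-comm f g = coeffwise λ N → trans
  (sum-cong N (λ i i≤N → trans (ℤₚ.*-comm (f i) (g (N ∸ i)))
    (cong (λ x → g (N ∸ i) * f x) (sym (ℕₚ.m∸[m∸n]≡n i≤N)))))
  (sum-reverse N (λ i → g i * f (N ∸ i)))

⊛-assoc : ∀ f g h → (f ⊛ g) ⊛ h ≈ f ⊛ (g ⊛ h)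
⊛-assoc f g h = coeffwise λ N → let
    a : ℕ → ℕ → ℤ
    a j k = f j * (g k * h (N ∸ (j ℕ.+ k)))
    in begin
  sumTo N (λ i → sumTo i (λ j → f j * g (i ∸ j)) * h (N ∸ i))
    ≡⟨ sum-cong′ N (λ i → sym (sum-*ʳ i (h (N ∸ i)) (λ j → f j * g (i ∸ j)))) ⟩
  sumTo N (λ i → sumTo i (λ j → (f j * g (i ∸ j)) * h (N ∸ i)))
    ≡⟨ sum-cong′ N (λ i → sum-cong i (λ j j≤i → trans (ℤₚ.*-assoc (f j) (g (i ∸ j)) (h (N ∸ i)))
         (cong (λ x → f j * (g (i ∸ j) * h (N ∸ x))) (sym (ℕₚ.m+[n∸m]≡n j≤i))))) ⟩
  sumTo N (λ i → sumTo i (λ j → a j (i ∸ j)))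
    ≡⟨ sum-triangle N a ⟩
  sumTo N (λ j → sumTo (N ∸ j) (a j))
    ≡⟨ sum-cong′ N (λ j → trans (sum-*ˡ (N ∸ j) (f j) _) (cong (λ x → f j * x)
         (sum-cong′ (N ∸ j) (λ k → cong (λ x → g k * h x) (sym (ℕₚ.∸-+-assoc N j k)))))) ⟩
  sumTo N (λ j → f j * sumTo (N ∸ j) (λ k → g k * h (N ∸ j ∸ k))) ∎
  where open ≡-Reasoning

⊛-identityˡ : ∀ f → 1s ⊛ f ≈ f
⊛-identityˡ f = coeffwise λ where
  zero    → ℤₚ.*-identityˡ (f 0)
  (suc N) → trans (sum-shift N (λ i → 1s i * f (suc N ∸ i)))
    (trans (cong₂ _+_ (ℤₚ.*-identityˡ (f (suc N))) (sum-zero N (λ _ _ → refl)))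
      (ℤₚ.+-identityʳ (f (suc N))))

⊛-distribˡ : ∀ f g h → f ⊛ (g ⊕ h) ≈ (f ⊛ g) ⊕ (f ⊛ h)
⊛-distribˡ f g h = coeffwise λ N → trans
  (sum-cong′ N (λ i → ℤₚ.*-distribˡ-+ (f i) (g (N ∸ i)) (h (N ∸ i))))
  (sum-+ N (λ i → f i * g (N ∸ i)) (λ i → f i * h (N ∸ i)))

⊛-cong : ∀ {f f′ g g′} → f ≈ f′ → g ≈ g′ → f ⊛ g ≈ f′ ⊛ g′
⊛-cong e e′ = coeffwise λ N → sum-cong′ N (λ i → cong₂ _*_ (at e i) (at e′ (N ∸ i)))

⊕-cong : ∀ {f f′ g g′} → f ≈ f′ → g ≈ g′ → f ⊕ g ≈ f′ ⊕ g′
⊕-cong e e′ = coeffwise λ N → cong₂ _+_ (at e N) (at e′ N)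

⊝-cong : ∀ {f g} → f ≈ g → ⊝ f ≈ ⊝ g
⊝-cong e = coeffwise λ N → cong -_ (at e N)

infixl 6 _+ˢ_ _-ˢ_
infixl 7 _*ˢ_
infix 8 -ˢ_

-- The operations of Defs unfold when applied to an index, which defeats unification;
-- sealed copies behave like constructors.
opaque
  _+ˢ_ _*ˢ_ : Series → Series → Series
  _+ˢ_ = _⊕_
  _*ˢ_ = _⊛_

  -ˢ_ : Series → Series
  -ˢ_ = ⊝_

  scalar : ℤ → Series
  scalar c = c · 1s

  isCommutativeRing : IsCommutativeRing _≈_ _+ˢ_ _*ˢ_ -ˢ_ 0s 1s
  isCommutativeRing = record
    { isRing = record
      { +-isAbelianGroup = record
        { isGroup = record
          { isMonoid = record
            { isSemigroup = record
              { isMagma = record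
                { isEquivalence = record { refl = ≈-refl ; sym = ≈-sym ; trans = ≈-trans }
                ; ∙-cong = ⊕-cong }
              ; assoc = λ f g h → coeffwise λ N → ℤₚ.+-assoc (f N) (g N) (h N) }
            ; identity = (λ f → coeffwise λ N → ℤₚ.+-identityˡ (f N))
                       , (λ f → coeffwise λ N → ℤₚ.+-identityʳ (f N)) }
          ; inverse = (λ f → coeffwise λ N → ℤₚ.+-inverseˡ (f N))
                    , (λ f → coeffwise λ N → ℤₚ.+-inverseʳ (f N))
          ; ⁻¹-cong = ⊝-cong }
        ; comm = λ f g → coeffwise λ N → ℤₚ.+-comm (f N) (g N) }
      ; *-cong = ⊛-cong
      ; *-assoc = ⊛-assoc
      ; *-identity = ⊛-identityˡ , (λ f → ≈-trans (⊛-comm f 1s) (⊛-identityˡ f))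
      ; distrib = ⊛-distribˡ , (λ f g h → ≈-trans (⊛-comm (g ⊕ h) f)
          (≈-trans (⊛-distribˡ f g h) (⊕-cong (⊛-comm f g) (⊛-comm f h)))) }
    ; *-comm = ⊛-comm }

  ·-scalar : ∀ c f → c · f ≈ scalar c *ˢ f
  ·-scalar c f = coeffwise λ N → sym (trans
    (trans (sum-cong′ N (λ i → ℤₚ.*-assoc c (1s i) (f (N ∸ i))))
      (sum-*ˡ N c (λ i → 1s i * f (N ∸ i))))
    (cong (λ x → c * x) (at (⊛-identityˡ f) N)))

  scalar-+ : ∀ c d → scalar (c + d) ≈ scalar c +ˢ scalar d
  scalar-+ c d = coeffwise λ N → ℤₚ.*-distribʳ-+ (1s N) c d

  scalar-* : ∀ c d → scalar (c * d) ≈ scalar c *ˢ scalar d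
  scalar-* c d = ≈-trans (coeffwise λ N → ℤₚ.*-assoc c d (1s N)) (·-scalar c (d · 1s))

  scalar-neg : ∀ c → scalar (- c) ≈ -ˢ scalar c
  scalar-neg c = coeffwise λ N → sym (ℤₚ.neg-distribˡ-* c (1s N))

  scalar-0 : scalar (+ 0) ≈ 0s
  scalar-0 = coeffwise λ _ → refl

  scalar-1 : scalar (+ 1) ≈ 1s
  scalar-1 = coeffwise λ N → ℤₚ.*-identityˡ (1s N)

-- The cases 0 and 1 make the solver's constants coincide with 0s and 1s definitionally.
const : ℤ → Series
const (+ 0) = 0s
const (+ 1) = 1s
const c     = scalar c

const≈scalar : ∀ c → const c ≈ scalar c
const≈scalar (+ 0)            = ≈-sym scalar-0
const≈scalar (+ 1)            = ≈-sym scalar-1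
const≈scalar (+ suc (suc _))  = ≈-refl
const≈scalar ℤ.-[1+ _ ]       = ≈-refl

_-ˢ_ : Series → Series → Series
f -ˢ g = f +ˢ (-ˢ g)

seriesRing : CommutativeRing 0ℓ 0ℓ
seriesRing = record { isCommutativeRing = isCommutativeRing }

open CommutativeRing seriesRing using ()
  renaming ( +-cong to +ˢ-cong ; *-cong to *ˢ-cong ; -‿cong to -ˢ-cong ; *-identityˡ to *ˢ-identityˡ
           ; *-comm to *ˢ-comm ; *-assoc to *ˢ-assoc ; zeroˡ to *ˢ-zeroˡ ; +-identityʳ to +ˢ-identityʳ )

module ≈-Reasoning = Relation.Binary.Reasoning.Setoid (CommutativeRing.setoid seriesRing)

const-+ : ∀ c d → const (c + d) ≈ const c +ˢ const d
const-+ c d = ≈-trans (const≈scalar (c + d)) (≈-trans (scalar-+ c d)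
  (+ˢ-cong (≈-sym (const≈scalar c)) (≈-sym (const≈scalar d))))

const-* : ∀ c d → const (c * d) ≈ const c *ˢ const d
const-* c d = ≈-trans (const≈scalar (c * d)) (≈-trans (scalar-* c d)
  (*ˢ-cong (≈-sym (const≈scalar c)) (≈-sym (const≈scalar d))))

const-neg : ∀ c → const (- c) ≈ -ˢ const c
const-neg c = ≈-trans (const≈scalar (- c)) (≈-trans (scalar-neg c)
  (-ˢ-cong (≈-sym (const≈scalar c))))

const-morphism : CommutativeRing.rawRing ℤₚ.+-*-commutativeRing -Raw-AlmostCommutative⟶ fromCommutativeRing seriesRing
const-morphism = record
  { ⟦_⟧ = const ; +-homo = const-+ ; *-homo = const-* ; -‿homo = const-neg
  ; 0-homo = ≈-refl ; 1-homo = ≈-refl }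

const-≟ : ∀ c d → Maybe (const c ≈ const d)
const-≟ c d = Maybe.map (λ { refl → ≈-refl }) (dec⇒maybe (c ℤ.≟ d))

module Solver = Algebra.Solver.Ring
  (CommutativeRing.rawRing ℤₚ.+-*-commutativeRing) (fromCommutativeRing seriesRing) const-morphism const-≟

open Algebra.Properties.Semiring.Exp (CommutativeRing.semiring seriesRing) using (_^_)
open Solver using (solve; _:=_; _:+_; _:*_; _:-_; :-_; con; _:^_)

-- The recursion for the inverse, and powers of `q`

tail-conv : Series → ℕ → ℕ → ℤ
tail-conv f i zero    = f (suc i) * + 1 + + 0
tail-conv f i (suc N) = f (suc i) * inv f (suc N) + tail-conv f (suc i) N

-- The recursion behind inv is private to Defs.  Abstracting its index 0 in the goal of inv-suc
-- makes the unifier fill in the left-hand side of conv-tail, which induction can then handle.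
mutual
  conv-tail : ∀ f i N → _ ≡ tail-conv f i N

  inv-suc : ∀ f N → inv f (suc N) ≡ - tail-conv f 0 N
  inv-suc f N with 0
  ... | i = cong -_ (conv-tail f i N)

  conv-tail f i zero    = refl
  conv-tail f i (suc N) = cong (λ x → f (suc i) * inv f (suc N) + x) (conv-tail f (suc i) N)

conv-sum : ∀ f i N → tail-conv f i N ≡ sumTo N (λ j → f (suc (i ℕ.+ j)) * inv f (N ∸ j))
conv-sum f i zero rewrite ℕₚ.+-identityʳ i = ℤₚ.+-identityʳ (f (suc i) * + 1)
conv-sum f i (suc N) = sym (trans (sum-shift N (λ j → f (suc (i ℕ.+ j)) * inv f (suc N ∸ j)))
  (cong₂ _+_ (cong (λ x → f (suc x) * inv f (suc N)) (ℕₚ.+-identityʳ i))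
    (trans (sum-cong′ N (λ j → cong (λ x → f (suc x) * inv f (N ∸ j)) (ℕₚ.+-suc i j)))
      (sym (conv-sum f (suc i) N)))))

infix 9 _⁻¹ q^_

opaque
  unfolding _*ˢ_

  _⁻¹ : Series → Series
  _⁻¹ = inv

  q^_ : ℕ → Series
  q^_ = qpow

  ⁻¹-inverse : ∀ f → f 0 ≡ + 1 → f *ˢ f ⁻¹ ≈ 1s
  ⁻¹-inverse f f₀ = coeffwise go
    where
    open ≡-Reasoning
    go : ∀ N → (f ⊛ inv f) N ≡ 1s N
    go zero    = cong (λ x → x * + 1) f₀
    go (suc N) = begin
      sumTo (suc N) (λ i → f i * inv f (suc N ∸ i))
        ≡⟨ sum-shift N (λ i → f i * inv f (suc N ∸ i)) ⟩
      f 0 * inv f (suc N) + sumTo N (λ i → f (suc i) * inv f (N ∸ i))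
        ≡⟨ cong₂ _+_ (trans (cong (λ x → x * inv f (suc N)) f₀) (ℤₚ.*-identityˡ (inv f (suc N))))
             (sym (conv-sum f 0 N)) ⟩
      inv f (suc N) + tail-conv f 0 N
        ≡⟨ cong (λ x → x + tail-conv f 0 N) (inv-suc f N) ⟩
      - tail-conv f 0 N + tail-conv f 0 N
        ≡⟨ ℤₚ.+-inverseˡ (tail-conv f 0 N) ⟩
      + 0 ∎

  *ˢ-constant-term : ∀ {f g} → f 0 ≡ + 1 → g 0 ≡ + 1 → (f *ˢ g) 0 ≡ + 1
  *ˢ-constant-term f₀ g₀ = cong₂ _*_ f₀ g₀

  qpow-refl : ∀ m → qpow m m ≡ + 1
  qpow-refl m with m ℕ.≟ m
  ... | yes _ = refl
  ... | no ¬p = contradiction refl ¬p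

  qpow-≢ : ∀ {m n} → m ≢ n → qpow m n ≡ + 0
  qpow-≢ {m} {n} m≢n with m ℕ.≟ n
  ... | yes p = contradiction p m≢n
  ... | no _  = refl

  q^0 : q^ 0 ≈ 1s
  q^0 = coeffwise λ { zero → refl ; (suc _) → refl }

  q*-suc : ∀ f N → (q^ 1 *ˢ f) (suc N) ≡ f N
  q*-suc f N = begin
    sumTo (suc N) (λ i → qs i * f (suc N ∸ i))
      ≡⟨ sum-shift N (λ i → qs i * f (suc N ∸ i)) ⟩
    + 0 + sumTo N (λ i → qs (suc i) * f (N ∸ i))
      ≡⟨ ℤₚ.+-identityˡ _ ⟩
    sumTo N (λ i → qs (suc i) * f (N ∸ i))
      ≡⟨ sum-cong′ N (λ i → cong (λ x → x * f (N ∸ i)) (qs-suc i)) ⟩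
    (1s *ˢ f) N
      ≡⟨ at (*ˢ-identityˡ f) N ⟩
    f N ∎
    where
    open ≡-Reasoning
    qs-suc : ∀ i → qs (suc i) ≡ 1s i
    qs-suc zero    = refl
    qs-suc (suc i) = refl

  q^-suc : ∀ m → q^ (suc m) ≈ q^ 1 *ˢ q^ m
  q^-suc m = coeffwise λ { zero → refl ; (suc N) → trans (step N) (sym (q*-suc (qpow m) N)) }
    where
    step : ∀ N → qpow (suc m) (suc N) ≡ qpow m N
    step N with m ℕ.≟ N
    ... | yes refl = qpow-refl (suc m)
    ... | no m≢N   = qpow-≢ (λ e → m≢N (ℕₚ.suc-injective e))

⁻¹-unique : ∀ {f g} → f 0 ≡ + 1 → f *ˢ g ≈ 1s → f ⁻¹ ≈ g
⁻¹-unique {f} {g} f₀ fg = begin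
  f ⁻¹               ≈⟨ *ˢ-identityˡ (f ⁻¹) ⟨
  1s *ˢ f ⁻¹         ≈⟨ *ˢ-cong fg ≈-refl ⟨
  (f *ˢ g) *ˢ f ⁻¹   ≈⟨ solve 3 (λ f g h → (f :* g) :* h := (f :* h) :* g) ≈-refl f g (f ⁻¹) ⟩
  (f *ˢ f ⁻¹) *ˢ g   ≈⟨ *ˢ-cong (⁻¹-inverse f f₀) ≈-refl ⟩
  1s *ˢ g            ≈⟨ *ˢ-identityˡ g ⟩
  g                  ∎
  where open ≈-Reasoning

q^-+ : ∀ m n → q^ (m ℕ.+ n) ≈ q^ m *ˢ q^ n
q^-+ zero    n = ≈-sym (≈-trans (*ˢ-cong q^0 ≈-refl) (*ˢ-identityˡ (q^ n)))
q^-+ (suc m) n = begin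
  q^ (suc (m ℕ.+ n))         ≈⟨ q^-suc (m ℕ.+ n) ⟩
  q^ 1 *ˢ q^ (m ℕ.+ n)       ≈⟨ *ˢ-cong ≈-refl (q^-+ m n) ⟩
  q^ 1 *ˢ (q^ m *ˢ q^ n)     ≈⟨ *ˢ-assoc (q^ 1) (q^ m) (q^ n) ⟨
  (q^ 1 *ˢ q^ m) *ˢ q^ n     ≈⟨ *ˢ-cong (q^-suc m) ≈-refl ⟨
  q^ (suc m) *ˢ q^ n         ∎
  where open ≈-Reasoning

q^-cong : ∀ {m n} → m ≡ n → q^ m ≈ q^ n
q^-cong refl = ≈-refl

q^-split : ∀ {l} m n → l ≡ m ℕ.+ n → q^ l ≈ q^ m *ˢ q^ n
q^-split m n e = ≈-trans (q^-cong e) (q^-+ m n)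

q^-shift : ∀ m f i → (q^ m *ˢ f) (m ℕ.+ i) ≡ f i
q^-shift zero    f i = at (≈-trans (*ˢ-cong q^0 ≈-refl) (*ˢ-identityˡ f)) i
q^-shift (suc m) f i = trans
  (at (≈-trans (*ˢ-cong (q^-suc m) ≈-refl) (*ˢ-assoc (q^ 1) (q^ m) f)) (suc (m ℕ.+ i)))
  (trans (q*-suc (q^ m *ˢ f) (m ℕ.+ i)) (q^-shift m f i))

-- Congruence modulo `q^n`

infix 4 _≈_[mod_]

record _≈_[mod_] (f g : Series) (n : ℕ) : Set where
  constructor below
  field get : ∀ N → N < n → f N ≡ g N

open _≈_[mod_]

module _ {n : ℕ} where

  mod-reflexive : ∀ {f g} → f ≈ g → f ≈ g [mod n ]
  mod-reflexive e = below λ N _ → at e N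

  mod-refl : ∀ {f} → f ≈ f [mod n ]
  mod-refl = below λ _ _ → refl

  mod-sym : ∀ {f g} → f ≈ g [mod n ] → g ≈ f [mod n ]
  mod-sym e = below λ N l → sym (get e N l)

  mod-trans : ∀ {f g h} → f ≈ g [mod n ] → g ≈ h [mod n ] → f ≈ h [mod n ]
  mod-trans e e′ = below λ N l → trans (get e N l) (get e′ N l)

  opaque
    unfolding _+ˢ_ q^_

    mod-+ˢ : ∀ {f f′ g g′} → f ≈ f′ [mod n ] → g ≈ g′ [mod n ] → f +ˢ g ≈ f′ +ˢ g′ [mod n ]
    mod-+ˢ e e′ = below λ N l → cong₂ _+_ (get e N l) (get e′ N l)

    mod--ˢ : ∀ {f f′} → f ≈ f′ [mod n ] → -ˢ f ≈ -ˢ f′ [mod n ]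
    mod--ˢ e = below λ N l → cong -_ (get e N l)

    mod-*ˢ : ∀ {f f′ g g′} → f ≈ f′ [mod n ] → g ≈ g′ [mod n ] → f *ˢ g ≈ f′ *ˢ g′ [mod n ]
    mod-*ˢ e e′ = below λ N l → sum-cong N (λ i i≤N →
      cong₂ _*_ (get e i (ℕₚ.≤-<-trans i≤N l)) (get e′ (N ∸ i) (ℕₚ.≤-<-trans (ℕₚ.m∸n≤m N i) l)))

    q^-small : ∀ {m} → n ≤ m → q^ m ≈ 0s [mod n ]
    q^-small n≤m = below λ N N<n → qpow-≢ (λ e → ℕₚ.<⇒≢ (ℕₚ.<-≤-trans N<n n≤m) (sym e))

  mod-*ˢ-zeroˡ : ∀ {f} g → f ≈ 0s [mod n ] → f *ˢ g ≈ 0s [mod n ]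
  mod-*ˢ-zeroˡ g e = mod-trans (mod-*ˢ e mod-refl) (mod-reflexive (*ˢ-zeroˡ g))

  mod-*ˢ-zeroʳ : ∀ {g} f → g ≈ 0s [mod n ] → f *ˢ g ≈ 0s [mod n ]
  mod-*ˢ-zeroʳ {g} f e = mod-trans (mod-reflexive (*ˢ-comm f g)) (mod-*ˢ-zeroˡ f e)

  mod-+ˢ-zeroʳ : ∀ {f g} → g ≈ 0s [mod n ] → f +ˢ g ≈ f [mod n ]
  mod-+ˢ-zeroʳ {f} e = mod-trans (mod-+ˢ mod-refl e) (mod-reflexive (+ˢ-identityʳ f))

  q^-*-small : ∀ {m} f → n ≤ m → q^ m *ˢ f ≈ 0s [mod n ]
  q^-*-small f n≤m = mod-*ˢ-zeroˡ f (q^-small n≤m)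

mod-≤ : ∀ {m n f g} → m ≤ n → f ≈ g [mod n ] → f ≈ g [mod m ]
mod-≤ m≤n e = below λ N l → get e N (ℕₚ.<-≤-trans l m≤n)

mod⇒≈ : ∀ {f g} → (∀ n → f ≈ g [mod n ]) → f ≈ g
mod⇒≈ e = coeffwise λ N → get (e (suc N)) N ℕₚ.≤-refl

q^-*-mod : ∀ m {n f g} → f ≈ g [mod n ] → q^ m *ˢ f ≈ q^ m *ˢ g [mod m ℕ.+ n ]
q^-*-mod m {n} {f} {g} e = below λ N l → helper N l
  where
  helper : ∀ N → N < m ℕ.+ n → (q^ m *ˢ f) N ≡ (q^ m *ˢ g) N
  helper N l with m ℕ.≤? N
  ... | no m≰N = trans (get (q^-*-small f ℕₚ.≤-refl) N (ℕₚ.≰⇒> m≰N))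
                   (sym (get (q^-*-small g ℕₚ.≤-refl) N (ℕₚ.≰⇒> m≰N)))
  ... | yes m≤N = subst (λ x → (q^ m *ˢ f) x ≡ (q^ m *ˢ g) x) m+i≡N (trans (q^-shift m f i)
      (trans (get e i (ℕₚ.+-cancelˡ-< m i n (subst (λ x → x < m ℕ.+ n) (sym m+i≡N) l)))
        (sym (q^-shift m g i))))
    where
    i = N ∸ m
    m+i≡N : m ℕ.+ i ≡ N
    m+i≡N = ℕₚ.m+[n∸m]≡n m≤N

-- Infinite sums of series

sumTo-swap : ∀ M N (a : ℕ → ℕ → ℤ) →
  sumTo M (λ i → sumTo N (a i)) ≡ sumTo N (λ j → sumTo M (λ i → a i j))
sumTo-swap zero    N a = refl
sumTo-swap (suc M) N a = trans (cong (λ x → x + sumTo N (a (suc M))) (sumTo-swap M N a))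
  (sym (sum-+ N (λ j → sumTo M (λ i → a i j)) (a (suc M))))

sumTo-extend : ∀ {M N} h → M ≤ N → (∀ i → M < i → h i ≡ + 0) → sumTo M h ≡ sumTo N h
sumTo-extend {M} h M≤N z = go (ℕₚ.≤⇒≤′ M≤N)
  where
  go : ∀ {N} → M ℕ.≤′ N → sumTo M h ≡ sumTo N h
  go ℕ.≤′-refl = refl
  go (ℕ.≤′-step {N} M≤N) = trans (go M≤N) (sym (trans
    (cong (λ x → sumTo N h + x) (z (suc N) (s≤s (ℕₚ.≤′⇒≤ M≤N)))) (ℤₚ.+-identityʳ (sumTo N h))))

-- `sumInf` reads the coefficient of `q^N` off the terms with `n ≤ N`. Under this condition nothing
-- is cut off, which is what shifting the index or multiplying by a series requires.
Summable : (ℕ → Series) → Set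
Summable F = ∀ n → F n ≈ 0s [mod n ]

opaque
  unfolding _+ˢ_

  Σ∞ : (ℕ → Series) → Series
  Σ∞ = sumInf

  Σ∞-cong : ∀ {F H} → (∀ n → F n ≈ H n) → Σ∞ F ≈ Σ∞ H
  Σ∞-cong e = coeffwise λ N → sum-cong′ N (λ n → at (e n) N)

  Σ∞-mod : ∀ {m F H} → (∀ n → F n ≈ H n [mod m ]) → Σ∞ F ≈ Σ∞ H [mod m ]
  Σ∞-mod e = below λ N l → sum-cong′ N (λ n → get (e n) N l)

  Σ∞-+ : ∀ F H → Σ∞ (λ n → F n +ˢ H n) ≈ Σ∞ F +ˢ Σ∞ H
  Σ∞-+ F H = coeffwise λ N → sum-+ N (λ n → F n N) (λ n → H n N)

  Σ∞-neg : ∀ F → Σ∞ (λ n → -ˢ F n) ≈ -ˢ Σ∞ F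
  Σ∞-neg F = coeffwise λ N → sum-neg N (λ n → F n N)

  Σ∞-- : ∀ F H → Σ∞ (λ n → F n -ˢ H n) ≈ Σ∞ F -ˢ Σ∞ H
  Σ∞-- F H = ≈-trans (Σ∞-+ F (λ n → -ˢ H n)) (+ˢ-cong (≈-refl {Σ∞ F}) (Σ∞-neg H))

  Σ∞-extend : ∀ {F N M} → Summable F → N ≤ M → Σ∞ F N ≡ sumTo M (λ n → F n N)
  Σ∞-extend {F} {N} s N≤M = sumTo-extend (λ n → F n N) N≤M (λ n N<n → get (s n) N N<n)

  Σ∞-zero : ∀ {F} → (∀ n → F n ≈ 0s) → Σ∞ F ≈ 0s
  Σ∞-zero e = coeffwise λ N → sum-zero N (λ n _ → at (e n) N)

  *-Σ∞ : ∀ a {F} → Summable F → a *ˢ Σ∞ F ≈ Σ∞ (λ n → a *ˢ F n)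
  *-Σ∞ a {F} s = coeffwise λ N → begin
    sumTo N (λ i → a i * Σ∞ F (N ∸ i))
      ≡⟨ sum-cong′ N (λ i → trans (cong (λ x → a i * x) (Σ∞-extend s (ℕₚ.m∸n≤m N i)))
           (sym (sum-*ˡ N (a i) (λ n → F n (N ∸ i))))) ⟩
    sumTo N (λ i → sumTo N (λ n → a i * F n (N ∸ i)))
      ≡⟨ sumTo-swap N N (λ i n → a i * F n (N ∸ i)) ⟩
    sumTo N (λ n → sumTo N (λ i → a i * F n (N ∸ i))) ∎
    where open ≡-Reasoning

  Σ∞-shift : ∀ {F} → Summable F → Σ∞ F ≈ F 0 +ˢ Σ∞ (λ n → F (suc n))
  Σ∞-shift {F} s = coeffwise λ N →
    trans (Σ∞-extend s (ℕₚ.n≤1+n N)) (sum-shift N (λ n → F n N))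

  Σ∞-head : ∀ {m F} → Summable F → (∀ n → F (suc n) ≈ 0s [mod m ]) → Σ∞ F ≈ F 0 [mod m ]
  Σ∞-head {m} {F} s e = mod-trans (mod-reflexive (Σ∞-shift s)) (below λ N l → trans
    (cong (λ x → F 0 N + x) (sum-zero N (λ n _ → get (e n) N l))) (ℤₚ.+-identityʳ (F 0 N)))

Σ∞-telescope : ∀ {T} → Summable T → Σ∞ (λ n → T n -ˢ T (suc n)) ≈ T 0
Σ∞-telescope {T} s = begin
  Σ∞ (λ n → T n -ˢ T (suc n))             ≈⟨ Σ∞-- T (λ n → T (suc n)) ⟩
  Σ∞ T -ˢ S                               ≈⟨ +ˢ-cong (Σ∞-shift s) ≈-refl ⟩
  (T 0 +ˢ S) -ˢ S                         ≈⟨ solve 2 (λ t s → (t :+ s) :- s := t) ≈-refl (T 0) S ⟩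
  T 0                                     ∎
  where
  open ≈-Reasoning
  S = Σ∞ (λ n → T (suc n))

-- Reciprocals and infinite products

open ≈-Reasoning

opaque
  unfolding _+ˢ_ q^_

  1+q^-constant : ∀ n → (1s +ˢ q^ (suc n)) 0 ≡ + 1
  1+q^-constant n = refl

  1-q^-constant : ∀ n → (1s -ˢ q^ (suc n)) 0 ≡ + 1
  1-q^-constant n = refl

-- Both sides are compared with `f ⁻¹ *ˢ (g *ˢ g ⁻¹)`, in which the middle `g` may be replaced by
-- `f`.
mod-⁻¹ : ∀ {n f g} → f 0 ≡ + 1 → g 0 ≡ + 1 → f ≈ g [mod n ] → f ⁻¹ ≈ g ⁻¹ [mod n ]
mod-⁻¹ {n} {f} {g} f₀ g₀ e = mod-trans (mod-reflexive (≈-sym left)) (mod-trans middle (mod-reflexive right))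
  where
  left : f ⁻¹ *ˢ (g *ˢ g ⁻¹) ≈ f ⁻¹
  left = ≈-trans (*ˢ-cong ≈-refl (⁻¹-inverse g g₀)) (≈-trans (*ˢ-comm (f ⁻¹) 1s) (*ˢ-identityˡ (f ⁻¹)))
  middle : f ⁻¹ *ˢ (g *ˢ g ⁻¹) ≈ f ⁻¹ *ˢ (f *ˢ g ⁻¹) [mod n ]
  middle = mod-*ˢ mod-refl (mod-*ˢ (mod-sym e) mod-refl)
  right : f ⁻¹ *ˢ (f *ˢ g ⁻¹) ≈ g ⁻¹
  right = begin
    f ⁻¹ *ˢ (f *ˢ g ⁻¹)   ≈⟨ solve 3 (λ a b c → a :* (b :* c) := (b :* a) :* c) ≈-refl (f ⁻¹) f (g ⁻¹) ⟩
    (f *ˢ f ⁻¹) *ˢ g ⁻¹   ≈⟨ *ˢ-cong (⁻¹-inverse f f₀) ≈-refl ⟩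
    1s *ˢ g ⁻¹            ≈⟨ *ˢ-identityˡ (g ⁻¹) ⟩
    g ⁻¹                  ∎

⁻¹-*ˢ : ∀ {f g} → f 0 ≡ + 1 → g 0 ≡ + 1 → (f *ˢ g) ⁻¹ ≈ f ⁻¹ *ˢ g ⁻¹
⁻¹-*ˢ {f} {g} f₀ g₀ = ⁻¹-unique (*ˢ-constant-term f₀ g₀) (begin
  (f *ˢ g) *ˢ (f ⁻¹ *ˢ g ⁻¹)
    ≈⟨ solve 4 (λ a b c d → (a :* b) :* (c :* d) := (a :* c) :* (b :* d)) ≈-refl f g (f ⁻¹) (g ⁻¹) ⟩
  (f *ˢ f ⁻¹) *ˢ (g *ˢ g ⁻¹)
    ≈⟨ *ˢ-cong (⁻¹-inverse f f₀) (⁻¹-inverse g g₀) ⟩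
  1s *ˢ 1s
    ≈⟨ *ˢ-identityˡ 1s ⟩
  1s ∎)

⁻¹-cancel : ∀ {f} g → f 0 ≡ + 1 → g 0 ≡ + 1 → f ⁻¹ ≈ g *ˢ (f *ˢ g) ⁻¹
⁻¹-cancel {f} g f₀ g₀ = ⁻¹-unique f₀ (≈-trans (≈-sym (*ˢ-assoc f g ((f *ˢ g) ⁻¹)))
  (⁻¹-inverse (f *ˢ g) (*ˢ-constant-term f₀ g₀)))

∏ : ℕ → (ℕ → Series) → Series
∏ zero    F = 1s
∏ (suc n) F = ∏ n F *ˢ F n

∏∞ : (ℕ → Series) → Series
∏∞ F N = ∏ (suc N) F N

∏-constant : ∀ {F} → (∀ i → F i 0 ≡ + 1) → ∀ n → ∏ n F 0 ≡ + 1
∏-constant F₀ zero    = refl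
∏-constant F₀ (suc n) = *ˢ-constant-term (∏-constant F₀ n) (F₀ n)

∏-cong : ∀ {F H} → (∀ i → F i ≈ H i) → ∀ n → ∏ n F ≈ ∏ n H
∏-cong e zero    = ≈-refl
∏-cong e (suc n) = *ˢ-cong (∏-cong e n) (e n)

-- The factors from index `n` on leave the coefficients up to `q^n` alone, so the diagonal
-- definition of `∏∞` is the true limit of the partial products.
Multipliable : (ℕ → Series) → Set
Multipliable F = ∀ n → F n ≈ 1s [mod suc n ]

∏-stable : ∀ {F} → Multipliable F → ∀ {n m} → n ≤ m → ∏ m F ≈ ∏ n F [mod suc n ]
∏-stable {F} u {n} n≤m = go (ℕₚ.≤⇒≤′ n≤m)
  where
  go : ∀ {m} → n ℕ.≤′ m → ∏ m F ≈ ∏ n F [mod suc n ]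
  go ℕ.≤′-refl = mod-refl
  go (ℕ.≤′-step {m} n≤m) = mod-trans
    (mod-*ˢ (go n≤m) (mod-≤ (s≤s (ℕₚ.≤′⇒≤ n≤m)) (u m)))
    (mod-reflexive (≈-trans (*ˢ-comm (∏ n F) 1s) (*ˢ-identityˡ (∏ n F))))

∏∞-limit : ∀ {F} → Multipliable F → ∀ n → ∏∞ F ≈ ∏ n F [mod suc n ]
∏∞-limit {F} u n = below λ N N≤n → sym (trans
  (get (∏-stable u (ℕₚ.≤-pred N≤n)) N ℕₚ.≤-refl)
  (sym (get (∏-stable u (ℕₚ.n≤1+n N)) N ℕₚ.≤-refl)))

1+q^-multipliable : Multipliable (λ i → 1s +ˢ q^ (suc i))
1+q^-multipliable n = mod-+ˢ-zeroʳ (q^-small ℕₚ.≤-refl)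

1-q^-multipliable : ∀ (e : ℕ → ℕ) → (∀ i → i < e i) → Multipliable (λ i → 1s -ˢ q^ (e i))
1-q^-multipliable e i<e n = mod-+ˢ-zeroʳ (mod-trans (mod--ˢ (q^-small (i<e n)))
  (mod-reflexive (solve 0 (:- con (+ 0) := con (+ 0)) ≈-refl)))

q^-^ : ∀ k i → q^ (i ℕ.* k) ≈ q^ k ^ i
q^-^ k zero    = q^0
q^-^ k (suc i) = ≈-trans (q^-+ k (i ℕ.* k)) (*ˢ-cong ≈-refl (q^-^ k i))

-- Writes powers of `q` as monomials in `q^k`, `q^r` and `q`, so that identities between exponents
-- become polynomial identities within reach of the ring solver.
q^-monomial : ∀ {e} k r i j l → e ≡ i ℕ.* k ℕ.+ j ℕ.* r ℕ.+ l ℕ.* 1 →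
  q^ e ≈ q^ k ^ i *ˢ q^ r ^ j *ˢ q^ 1 ^ l
q^-monomial k r i j l eq = ≈-trans (q^-split (i ℕ.* k ℕ.+ j ℕ.* r) (l ℕ.* 1) eq)
  (*ˢ-cong (≈-trans (q^-+ (i ℕ.* k) (j ℕ.* r)) (*ˢ-cong (q^-^ k i) (q^-^ r j))) (q^-^ 1 l))

-- The shifted series and the invariant 2 Z - β

-- m k = (-q;q)_k and p k = (q;q)_k
m p v w : ℕ → Series
m k = ∏ k (λ i → 1s +ˢ q^ (suc i))
p k = ∏ k (λ i → 1s -ˢ q^ (suc i))
v k = m k ⁻¹
w k = p k ⁻¹

m-constant : ∀ k → m k 0 ≡ + 1
m-constant = ∏-constant 1+q^-constant

p-constant : ∀ k → p k 0 ≡ + 1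
p-constant = ∏-constant 1-q^-constant

v-suc : ∀ k → v k ≈ (1s +ˢ q^ (suc k)) *ˢ v (suc k)
v-suc k = ⁻¹-cancel (1s +ˢ q^ (suc k)) (m-constant k) (1+q^-constant k)

w-suc : ∀ k → w k ≈ (1s -ˢ q^ (suc k)) *ˢ w (suc k)
w-suc k = ⁻¹-cancel (1s -ˢ q^ (suc k)) (p-constant k) (1-q^-constant k)

1⁻¹ : 1s ⁻¹ ≈ 1s
1⁻¹ = ⁻¹-unique refl (*ˢ-identityˡ 1s)

m∞ p∞ v∞ : Series
m∞ = ∏∞ (λ i → 1s +ˢ q^ (suc i))
p∞ = ∏∞ (λ i → 1s -ˢ q^ (suc i))
v∞ = m∞ ⁻¹

v-limit : ∀ k → v k ≈ v∞ [mod suc k ]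
-- `m-constant 1` serves for `m∞`: coefficient 0 of `∏∞` is read off the product of one factor.
v-limit k = mod-sym (mod-⁻¹ (m-constant 1) (m-constant k) (∏∞-limit 1+q^-multipliable k))

G-term : ℕ → ℕ → Series
G-term k m = q^ (m ℕ.* m ℕ.+ k ℕ.* m) *ˢ w m

G : ℕ → Series
G k = Σ∞ (G-term k)

n≤n*n : ∀ n → n ≤ n ℕ.* n
n≤n*n zero    = z≤n
n≤n*n (suc n) = ℕₚ.m≤m*n (suc n) (suc n)

G-summable : ∀ k → Summable (G-term k)
G-summable k n = q^-*-small (w n) (ℕₚ.≤-trans (n≤n*n n) (ℕₚ.m≤m+n _ _))

-- Split `1 = q^n + (1 - q^n)` in the summand. The first part gives `G (suc k)`; in the second,
-- `(1 - q^n)/(q)_n = 1/(q)_(n-1)`, and a shift of the index leaves `q^(k+1) G_(k+2)`.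
G-rec : ∀ k → G k ≈ G (suc k) +ˢ q^ (suc k) *ˢ G (suc (suc k))
G-rec k = begin
  G k
    ≈⟨ Σ∞-cong split ⟩
  Σ∞ (λ n → G-term (suc k) n +ˢ D n)
    ≈⟨ Σ∞-+ (G-term (suc k)) D ⟩
  G (suc k) +ˢ Σ∞ D
    ≈⟨ +ˢ-cong ≈-refl (Σ∞-shift D-summable) ⟩
  G (suc k) +ˢ (D 0 +ˢ Σ∞ (λ n → D (suc n)))
    ≈⟨ +ˢ-cong ≈-refl (+ˢ-cong D-zero (Σ∞-cong D-suc)) ⟩
  G (suc k) +ˢ (0s +ˢ Σ∞ (λ n → q^ (suc k) *ˢ G-term (suc (suc k)) n))
    ≈⟨ +ˢ-cong ≈-refl (solve 1 (λ x → con (+ 0) :+ x := x) ≈-refl _) ⟩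
  G (suc k) +ˢ Σ∞ (λ n → q^ (suc k) *ˢ G-term (suc (suc k)) n)
    ≈⟨ +ˢ-cong ≈-refl (*-Σ∞ (q^ (suc k)) (G-summable (suc (suc k)))) ⟨
  G (suc k) +ˢ q^ (suc k) *ˢ G (suc (suc k)) ∎
  where
  D : ℕ → Series
  D n = q^ (n ℕ.* n ℕ.+ k ℕ.* n) *ˢ ((1s -ˢ q^ n) *ˢ w n)
  D-summable : Summable D
  D-summable n = q^-*-small _ (ℕₚ.≤-trans (n≤n*n n) (ℕₚ.m≤m+n _ _))
  split : ∀ n → G-term k n ≈ G-term (suc k) n +ˢ D n
  split n = begin
    e *ˢ w n
      ≈⟨ solve 3 (λ e u w → e :* w := e :* u :* w :+ e :* ((con (+ 1) :- u) :* w)) ≈-refl e (q^ n) (w n) ⟩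
    e *ˢ q^ n *ˢ w n +ˢ D n
      ≈⟨ +ˢ-cong (*ˢ-cong (q^-split _ n (eq n k)) ≈-refl) ≈-refl ⟨
    G-term (suc k) n +ˢ D n ∎
    where
    e = q^ (n ℕ.* n ℕ.+ k ℕ.* n)
    eq : ∀ n k → n ℕ.* n ℕ.+ suc k ℕ.* n ≡ (n ℕ.* n ℕ.+ k ℕ.* n) ℕ.+ n
    eq = solve-∀
  D-zero : D 0 ≈ 0s
  D-zero = ≈-trans (*ˢ-cong ≈-refl (*ˢ-cong (+ˢ-cong ≈-refl (-ˢ-cong q^0)) ≈-refl))
    (solve 2 (λ e w → e :* ((con (+ 1) :- con (+ 1)) :* w) := con (+ 0)) ≈-refl _ _)
  D-suc : ∀ n → D (suc n) ≈ q^ (suc k) *ˢ G-term (suc (suc k)) n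
  D-suc n = begin
    q^ (suc n ℕ.* suc n ℕ.+ k ℕ.* suc n) *ˢ ((1s -ˢ q^ (suc n)) *ˢ w (suc n))
      ≈⟨ *ˢ-cong (q^-split (suc k) _ (eq n k)) (≈-sym (w-suc n)) ⟩
    (q^ (suc k) *ˢ q^ (n ℕ.* n ℕ.+ suc (suc k) ℕ.* n)) *ˢ w n
      ≈⟨ *ˢ-assoc _ _ _ ⟩
    q^ (suc k) *ˢ G-term (suc (suc k)) n ∎
    where
    eq : ∀ n k → suc n ℕ.* suc n ℕ.+ k ℕ.* suc n ≡ suc k ℕ.+ (n ℕ.* n ℕ.+ suc (suc k) ℕ.* n)
    eq = solve-∀

G-limit : ∀ k → G k ≈ 1s [mod suc k ]
G-limit k = mod-trans (Σ∞-head (G-summable k) small) (mod-reflexive (begin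
  q^ (k ℕ.* 0) *ˢ w 0   ≈⟨ *ˢ-cong (≈-trans (q^-cong (ℕₚ.*-zeroʳ k)) q^0) 1⁻¹ ⟩
  1s *ˢ 1s              ≈⟨ *ˢ-identityˡ 1s ⟩
  1s                    ∎))
  where
  small : ∀ n → G-term k (suc n) ≈ 0s [mod suc k ]
  small n = q^-*-small (w (suc n)) (ℕₚ.+-mono-≤ {1} (s≤s z≤n) (ℕₚ.m≤m*n k (suc n)))

Xₖ-term χₖ-term : ℕ → ℕ → Series
Xₖ-term k n = const (sgn n) *ˢ (q^ (n ℕ.* n) *ˢ v (k ℕ.+ 2 ℕ.* n))
χₖ-term k n = const (sgn n) *ˢ (q^ (suc n ℕ.* suc n) *ˢ v (suc (k ℕ.+ 2 ℕ.* n)))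

Xₖ χₖ : ℕ → Series
Xₖ k = Σ∞ (Xₖ-term k)
χₖ k = Σ∞ (χₖ-term k)

Xₖ-summable : ∀ k → Summable (Xₖ-term k)
Xₖ-summable k n = mod-*ˢ-zeroʳ _ (q^-*-small _ (n≤n*n n))

χₖ-summable : ∀ k → Summable (χₖ-term k)
χₖ-summable k n = mod-*ˢ-zeroʳ _ (q^-*-small _ (ℕₚ.≤-trans (ℕₚ.n≤1+n n) (n≤n*n (suc n))))

-- Apply `v_l = (1 + q^(l+1)) v_(l+1)` with `l = k + 2n` and complete the square:
-- `n² + k + 2n + 1 = k + (n+1)²`.
Xₖ-suc : ∀ k → Xₖ k ≈ Xₖ (suc k) +ˢ q^ k *ˢ χₖ k
Xₖ-suc k = begin
  Xₖ k                                                   ≈⟨ Σ∞-cong split ⟩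
  Σ∞ (λ n → Xₖ-term (suc k) n +ˢ q^ k *ˢ χₖ-term k n)     ≈⟨ Σ∞-+ _ _ ⟩
  Xₖ (suc k) +ˢ Σ∞ (λ n → q^ k *ˢ χₖ-term k n)            ≈⟨ +ˢ-cong ≈-refl (*-Σ∞ (q^ k) (χₖ-summable k)) ⟨
  Xₖ (suc k) +ˢ q^ k *ˢ χₖ k                              ∎
  where
  split : ∀ n → Xₖ-term k n ≈ Xₖ-term (suc k) n +ˢ q^ k *ˢ χₖ-term k n
  split n = begin
    s *ˢ (e *ˢ v l)
      ≈⟨ *ˢ-cong ≈-refl (*ˢ-cong ≈-refl (v-suc l)) ⟩
    s *ˢ (e *ˢ ((1s +ˢ q^ (suc l)) *ˢ v (suc l)))
      ≈⟨ solve 4 (λ s e r x → s :* (e :* ((con (+ 1) :+ r) :* x)) := s :* (e :* x) :+ s :* ((e :* r) :* x))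
           ≈-refl s e (q^ (suc l)) (v (suc l)) ⟩
    s *ˢ (e *ˢ v (suc l)) +ˢ s *ˢ ((e *ˢ q^ (suc l)) *ˢ v (suc l))
      ≈⟨ +ˢ-cong ≈-refl (*ˢ-cong ≈-refl (*ˢ-cong exponent ≈-refl)) ⟩
    s *ˢ (e *ˢ v (suc l)) +ˢ s *ˢ ((q^ k *ˢ e′) *ˢ v (suc l))
      ≈⟨ +ˢ-cong ≈-refl (solve 4 (λ s a e x → s :* ((a :* e) :* x) := a :* (s :* (e :* x)))
           ≈-refl s (q^ k) e′ (v (suc l))) ⟩
    Xₖ-term (suc k) n +ˢ q^ k *ˢ χₖ-term k n ∎
    where
    s = const (sgn n)
    e = q^ (n ℕ.* n)
    e′ = q^ (suc n ℕ.* suc n)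
    l = k ℕ.+ 2 ℕ.* n
    eq : ∀ n k → n ℕ.* n ℕ.+ suc (k ℕ.+ 2 ℕ.* n) ≡ k ℕ.+ suc n ℕ.* suc n
    eq = solve-∀
    exponent : e *ˢ q^ (suc l) ≈ q^ k *ˢ e′
    exponent = ≈-trans (≈-sym (q^-+ (n ℕ.* n) (suc l))) (q^-split k (suc n ℕ.* suc n) (eq n k))

-- The term `n = 0` of `Xₖ k` is `v k`; the remaining ones, renumbered, are those of `χₖ (suc k)`
-- with opposite sign.
χₖ-suc : ∀ k → χₖ (suc k) ≈ v k -ˢ Xₖ k
χₖ-suc k = ≈-sym (begin
  v k -ˢ Xₖ k
    ≈⟨ +ˢ-cong ≈-refl (-ˢ-cong (Σ∞-shift (Xₖ-summable k))) ⟩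
  v k -ˢ (Xₖ-term k 0 +ˢ Σ∞ (λ n → Xₖ-term k (suc n)))
    ≈⟨ +ˢ-cong ≈-refl (-ˢ-cong (+ˢ-cong first (≈-trans (Σ∞-cong next) (Σ∞-neg (χₖ-term (suc k)))))) ⟩
  v k -ˢ (v k +ˢ -ˢ χₖ (suc k))
    ≈⟨ solve 2 (λ v c → v :- (v :+ :- c) := c) ≈-refl (v k) (χₖ (suc k)) ⟩
  χₖ (suc k) ∎)
  where
  first : Xₖ-term k 0 ≈ v k
  first = begin
    1s *ˢ (q^ 0 *ˢ v (k ℕ.+ 0))   ≈⟨ *ˢ-cong ≈-refl (*ˢ-cong q^0 (≡⇒≈ v (ℕₚ.+-identityʳ k))) ⟩
    1s *ˢ (1s *ˢ v k)             ≈⟨ solve 1 (λ v → con (+ 1) :* (con (+ 1) :* v) := v) ≈-refl (v k) ⟩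
    v k                           ∎
    where
    ≡⇒≈ : ∀ (f : ℕ → Series) {i j} → i ≡ j → f i ≈ f j
    ≡⇒≈ f refl = ≈-refl
  eq : ∀ n k → k ℕ.+ 2 ℕ.* suc n ≡ suc (suc k ℕ.+ 2 ℕ.* n)
  eq = solve-∀
  next : ∀ n → Xₖ-term k (suc n) ≈ -ˢ χₖ-term (suc k) n
  next n rewrite eq n k = begin
    const (- sgn n) *ˢ (e *ˢ x)   ≈⟨ *ˢ-cong (const-neg (sgn n)) ≈-refl ⟩
    -ˢ s *ˢ (e *ˢ x)              ≈⟨ solve 2 (λ s y → :- s :* y := :- (s :* y)) ≈-refl s (e *ˢ x) ⟩
    -ˢ (s *ˢ (e *ˢ x))            ∎
    where
    s = const (sgn n)
    e = q^ (suc n ℕ.* suc n)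
    x = v (suc (suc k ℕ.+ 2 ℕ.* n))

Z : ℕ → Series
Z k = Xₖ k *ˢ G k -ˢ q^ k *ˢ χₖ k *ˢ G (suc k)

Z-suc : ∀ k → Z k ≈ Z (suc k) +ˢ v k *ˢ (G k -ˢ G (suc k))
Z-suc k = begin
  Xₖ k *ˢ G k -ˢ E *ˢ B
    ≈⟨ +ˢ-cong (*ˢ-cong (Xₖ-suc k) (G-rec k)) ≈-refl ⟩
  (X′ +ˢ E) *ˢ (B +ˢ Q *ˢ C) -ˢ E *ˢ B
    ≈⟨ solve 6 (λ x e b q c v →
         (x :+ e) :* (b :+ q :* c) :- e :* b :=
         (x :* b :- q :* (v :- (x :+ e)) :* c) :+ v :* ((b :+ q :* c) :- b)) ≈-refl X′ E B Q C (v k) ⟩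
  (X′ *ˢ B -ˢ Q *ˢ (v k -ˢ (X′ +ˢ E)) *ˢ C) +ˢ v k *ˢ ((B +ˢ Q *ˢ C) -ˢ B)
    ≈⟨ +ˢ-cong
         (+ˢ-cong ≈-refl (-ˢ-cong (*ˢ-cong (*ˢ-cong ≈-refl
           (≈-trans (χₖ-suc k) (+ˢ-cong ≈-refl (-ˢ-cong (Xₖ-suc k))))) ≈-refl)))
         (*ˢ-cong ≈-refl (+ˢ-cong (G-rec k) ≈-refl)) ⟨
  Z (suc k) +ˢ v k *ˢ (G k -ˢ B) ∎
  where
  X′ = Xₖ (suc k)
  E = q^ k *ˢ χₖ k
  Q = q^ (suc k)
  B = G (suc k)
  C = G (suc (suc k))

β-term : ℕ → ℕ → Series
β-term k n = q^ (2 ℕ.* (n ℕ.* n ℕ.+ k ℕ.* n)) *ˢ (v n *ˢ (v (k ℕ.+ n) *ˢ G (k ℕ.+ 2 ℕ.* n)))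

β : ℕ → Series
β k = Σ∞ (β-term k)

exponent-≥ : ∀ k n → n ≤ 2 ℕ.* (n ℕ.* n ℕ.+ k ℕ.* n)
exponent-≥ k n = ℕₚ.≤-trans (n≤n*n n) (ℕₚ.≤-trans (ℕₚ.m≤m+n (n ℕ.* n) (k ℕ.* n)) (ℕₚ.m≤m+n _ _))

β-summable : ∀ k → Summable (β-term k)
β-summable k n = q^-*-small _ (exponent-≥ k n)

β-suc : ∀ k → β k ≈ β (suc k) +ˢ const (+ 2) *ˢ (v k *ˢ (G k -ˢ G (suc k)))
β-suc k = begin
  β k
    ≈⟨ solve 2 (λ x y → x := y :+ (x :- y)) ≈-refl (β k) (β (suc k)) ⟩
  β (suc k) +ˢ (β k -ˢ β (suc k))
    ≈⟨ +ˢ-cong ≈-refl (Σ∞-- (β-term k) (β-term (suc k))) ⟨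
  β (suc k) +ˢ Σ∞ (λ n → β-term k n -ˢ β-term (suc k) n)
    ≈⟨ +ˢ-cong ≈-refl (≈-trans (Σ∞-cong step) (Σ∞-telescope T-summable)) ⟩
  β (suc k) +ˢ T 0
    ≈⟨ +ˢ-cong ≈-refl T-zero ⟩
  β (suc k) +ˢ const (+ 2) *ˢ (v k *ˢ (G k -ˢ G (suc k))) ∎
  where
  -- The telescoping certificate: each difference of summands is `T n -ˢ T (suc n)`, so only `T 0`
  -- survives, where `1 + q^n` becomes the factor 2.
  T : ℕ → Series
  T n = q^ (2 ℕ.* (n ℕ.* n ℕ.+ k ℕ.* n)) *ˢ (v n *ˢ (v (k ℕ.+ n) *ˢ
          ((1s +ˢ q^ n) *ˢ (G (k ℕ.+ 2 ℕ.* n) -ˢ q^ n *ˢ G (suc (k ℕ.+ 2 ℕ.* n))))))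
  T-summable : Summable T
  T-summable n = q^-*-small _ (exponent-≥ k n)
  T-zero : T 0 ≈ const (+ 2) *ˢ (v k *ˢ (G k -ˢ G (suc k)))
  T-zero rewrite ℕₚ.*-zeroʳ k | ℕₚ.+-identityʳ k = begin
    q^ 0 *ˢ (v 0 *ˢ (v k *ˢ ((1s +ˢ q^ 0) *ˢ (G k -ˢ q^ 0 *ˢ G (suc k)))))
      ≈⟨ *ˢ-cong q^0 (*ˢ-cong 1⁻¹ (*ˢ-cong ≈-refl (*ˢ-cong (+ˢ-cong ≈-refl q^0)
           (+ˢ-cong ≈-refl (-ˢ-cong (*ˢ-cong q^0 ≈-refl)))))) ⟩
    1s *ˢ (1s *ˢ (v k *ˢ ((1s +ˢ 1s) *ˢ (G k -ˢ 1s *ˢ G (suc k)))))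
      ≈⟨ solve 3 (λ v a b → con (+ 1) :* (con (+ 1) :* (v :* ((con (+ 1) :+ con (+ 1)) :* (a :- con (+ 1) :* b))))
           := con (+ 2) :* (v :* (a :- b))) ≈-refl (v k) (G k) (G (suc k)) ⟩
    const (+ 2) *ˢ (v k *ˢ (G k -ˢ G (suc k))) ∎
  step : ∀ n → β-term k n -ˢ β-term (suc k) n ≈ T n -ˢ T (suc n)
  step n = begin
    M *ˢ (v n *ˢ (v (k ℕ.+ n) *ˢ g₀)) -ˢ q^ (2 ℕ.* (n ℕ.* n ℕ.+ suc k ℕ.* n)) *ˢ (v n *ˢ (y *ˢ g₁))
      ≈⟨ +ˢ-cong (*ˢ-cong ≈-refl (*ˢ-cong vₙ (*ˢ-cong vₖₙ G₀)))
           (-ˢ-cong (*ˢ-cong M-k (*ˢ-cong vₙ (*ˢ-cong ≈-refl G₁)))) ⟩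
    M *ˢ (vₙ′ *ˢ (vₖₙ′ *ˢ G₀′)) -ˢ (M *ˢ (u *ˢ u)) *ˢ (vₙ′ *ˢ (y *ˢ G₁′))
      -- All `v` and `G` have been pushed up to the indices that occur in `T (suc n)`. What remains
      -- is a polynomial identity in eight quantities treated as independent.
      ≈⟨ solve 8 (λ M u a Q x y g₂ g₃ →
          let vₙ  = (con (+ 1) :+ u :* Q) :* x
              vₖₙ = (con (+ 1) :+ a :* u :* Q) :* y
              G₁  = g₂ :+ (a :* u :* u :* Q :* Q) :* g₃
              G₀  = G₁ :+ (a :* u :* u :* Q) :* g₂
          in M :* (vₙ :* (vₖₙ :* G₀)) :- (M :* (u :* u)) :* (vₙ :* (y :* G₁)) :=
             M :* (vₙ :* (vₖₙ :* ((con (+ 1) :+ u) :* (G₀ :- u :* G₁)))) :-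
             (M :* (a :^ 2 :* u :^ 4 :* Q :^ 2)) :* (x :* (y :* ((con (+ 1) :+ u :* Q) :* (g₂ :- (u :* Q) :* g₃)))))
         ≈-refl M u a Q x y g₂ g₃ ⟩
    M *ˢ (vₙ′ *ˢ (vₖₙ′ *ˢ ((1s +ˢ u) *ˢ (G₀′ -ˢ u *ˢ G₁′)))) -ˢ
    (M *ˢ (a ^ 2 *ˢ u ^ 4 *ˢ Q ^ 2)) *ˢ (x *ˢ (y *ˢ ((1s +ˢ u *ˢ Q) *ˢ (g₂ -ˢ (u *ˢ Q) *ˢ g₃))))
      ≈⟨ +ˢ-cong (*ˢ-cong ≈-refl (*ˢ-cong vₙ (*ˢ-cong vₖₙ (*ˢ-cong ≈-refl (+ˢ-cong G₀ (-ˢ-cong (*ˢ-cong ≈-refl G₁)))))))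
           (-ˢ-cong (*ˢ-cong M-n (*ˢ-cong ≈-refl (*ˢ-cong ≈-refl
             (*ˢ-cong (+ˢ-cong ≈-refl uQ) (+ˢ-cong ≈-refl (-ˢ-cong (*ˢ-cong uQ ≈-refl)))))))) ⟨
    T n -ˢ q^ (2 ℕ.* (suc n ℕ.* suc n ℕ.+ k ℕ.* suc n)) *ˢ
      (x *ˢ (y *ˢ ((1s +ˢ q^ (suc n)) *ˢ (g₂ -ˢ q^ (suc n) *ˢ g₃))))
      ≡⟨ cong₂ (λ i j → T n -ˢ q^ (2 ℕ.* (suc n ℕ.* suc n ℕ.+ k ℕ.* suc n)) *ˢ
           (x *ˢ (v i *ˢ ((1s +ˢ q^ (suc n)) *ˢ (G j -ˢ q^ (suc n) *ˢ G (suc j)))))) (eqᵢ n k) (eqⱼ n k) ⟩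
    T n -ˢ T (suc n) ∎
    where
    l = k ℕ.+ 2 ℕ.* n
    M = q^ (2 ℕ.* (n ℕ.* n ℕ.+ k ℕ.* n))
    u = q^ n
    a = q^ k
    Q = q^ 1
    x = v (suc n)
    y = v (suc (k ℕ.+ n))
    g₀ = G l
    g₁ = G (suc l)
    g₂ = G (suc (suc l))
    g₃ = G (suc (suc (suc l)))
    vₙ′ = (1s +ˢ u *ˢ Q) *ˢ x
    vₖₙ′ = (1s +ˢ a *ˢ u *ˢ Q) *ˢ y
    G₁′ = g₂ +ˢ (a *ˢ u *ˢ u *ˢ Q *ˢ Q) *ˢ g₃
    G₀′ = G₁′ +ˢ (a *ˢ u *ˢ u *ˢ Q) *ˢ g₂
    eqᵢ : ∀ n k → suc (k ℕ.+ n) ≡ k ℕ.+ suc n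
    eqᵢ = solve-∀
    eqⱼ : ∀ n k → suc (suc (k ℕ.+ 2 ℕ.* n)) ≡ k ℕ.+ 2 ℕ.* suc n
    eqⱼ = solve-∀
    uQ : q^ (suc n) ≈ u *ˢ Q
    uQ = q^-split n 1 (ℕₚ.+-comm 1 n)
    auQ : q^ (suc (k ℕ.+ n)) ≈ a *ˢ u *ˢ Q
    auQ = ≈-trans (q^-split (k ℕ.+ n) 1 (ℕₚ.+-comm 1 _)) (*ˢ-cong (q^-+ k n) ≈-refl)
    R : q^ (suc l) ≈ a *ˢ u *ˢ u *ˢ Q
    R = ≈-trans (q^-split (k ℕ.+ n ℕ.+ n) 1 (eq n k))
          (*ˢ-cong (≈-trans (q^-+ (k ℕ.+ n) n) (*ˢ-cong (q^-+ k n) ≈-refl)) ≈-refl)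
      where
      eq : ∀ n k → suc (k ℕ.+ 2 ℕ.* n) ≡ k ℕ.+ n ℕ.+ n ℕ.+ 1
      eq = solve-∀
    RQ : q^ (suc (suc l)) ≈ a *ˢ u *ˢ u *ˢ Q *ˢ Q
    RQ = ≈-trans (q^-split (suc l) 1 (ℕₚ.+-comm 1 _)) (*ˢ-cong R ≈-refl)
    vₙ : v n ≈ vₙ′
    vₙ = ≈-trans (v-suc n) (*ˢ-cong (+ˢ-cong ≈-refl uQ) ≈-refl)
    vₖₙ : v (k ℕ.+ n) ≈ vₖₙ′
    vₖₙ = ≈-trans (v-suc (k ℕ.+ n)) (*ˢ-cong (+ˢ-cong ≈-refl auQ) ≈-refl)
    G₁ : g₁ ≈ G₁′
    G₁ = ≈-trans (G-rec (suc l)) (+ˢ-cong ≈-refl (*ˢ-cong RQ ≈-refl))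
    G₀ : g₀ ≈ G₀′
    G₀ = ≈-trans (G-rec l) (+ˢ-cong G₁ (*ˢ-cong R ≈-refl))
    M-k : q^ (2 ℕ.* (n ℕ.* n ℕ.+ suc k ℕ.* n)) ≈ M *ˢ (u *ˢ u)
    M-k = ≈-trans (q^-split (2 ℕ.* (n ℕ.* n ℕ.+ k ℕ.* n)) (n ℕ.+ n) (eq n k)) (*ˢ-cong ≈-refl (q^-+ n n))
      where
      eq : ∀ n k → 2 ℕ.* (n ℕ.* n ℕ.+ suc k ℕ.* n) ≡ 2 ℕ.* (n ℕ.* n ℕ.+ k ℕ.* n) ℕ.+ (n ℕ.+ n)
      eq = solve-∀
    M-n : q^ (2 ℕ.* (suc n ℕ.* suc n ℕ.+ k ℕ.* suc n)) ≈ M *ˢ (a ^ 2 *ˢ u ^ 4 *ˢ Q ^ 2)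
    M-n = ≈-trans (q^-split (2 ℕ.* (n ℕ.* n ℕ.+ k ℕ.* n)) _ (eq n k)) (*ˢ-cong ≈-refl (q^-monomial k n 2 4 2 refl))
      where
      eq : ∀ n k → 2 ℕ.* (suc n ℕ.* suc n ℕ.+ k ℕ.* suc n) ≡
           2 ℕ.* (n ℕ.* n ℕ.+ k ℕ.* n) ℕ.+ (2 ℕ.* k ℕ.+ 4 ℕ.* n ℕ.+ 2 ℕ.* 1)
      eq = solve-∀

-- The limit of the invariant as `k` grows

ϑ-term : ℕ → Series
ϑ-term n = const (sgn n) *ˢ q^ (n ℕ.* n)

-- Half of the theta series: `n` and `-n` contribute equally, so the sum of `(-1)^n q^(n²)` over all
-- integers is `2ϑ - 1`.
ϑ : Series
ϑ = Σ∞ ϑ-term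

ϑ-summable : Summable ϑ-term
ϑ-summable n = mod-*ˢ-zeroʳ _ (q^-small (n≤n*n n))

Xₖ-limit : ∀ k → Xₖ k ≈ ϑ *ˢ v∞ [mod suc k ]
Xₖ-limit k = mod-trans (Σ∞-mod term) (mod-reflexive (begin
  Σ∞ (λ n → v∞ *ˢ ϑ-term n)   ≈⟨ *-Σ∞ v∞ ϑ-summable ⟨
  v∞ *ˢ ϑ                     ≈⟨ *ˢ-comm v∞ ϑ ⟩
  ϑ *ˢ v∞                     ∎))
  where
  term : ∀ n → Xₖ-term k n ≈ v∞ *ˢ ϑ-term n [mod suc k ]
  term n = mod-trans
    (mod-*ˢ mod-refl (mod-*ˢ mod-refl (mod-≤ (s≤s (ℕₚ.m≤m+n k (2 ℕ.* n))) (v-limit (k ℕ.+ 2 ℕ.* n)))))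
    (mod-reflexive (solve 3 (λ s e v → s :* (e :* v) := v :* (s :* e)) ≈-refl
      (const (sgn n)) (q^ (n ℕ.* n)) v∞))

β-limit : ∀ k → β k ≈ v∞ [mod suc k ]
β-limit k = mod-trans (Σ∞-head (β-summable k) small) (mod-trans head (v-limit k))
  where
  small : ∀ n → β-term k (suc n) ≈ 0s [mod suc k ]
  small n = q^-*-small _ (ℕₚ.≤-trans
    (ℕₚ.+-mono-≤ {1} {suc n ℕ.* suc n} (s≤s z≤n) (ℕₚ.m≤m*n k (suc n)))
    (ℕₚ.m≤m+n (suc n ℕ.* suc n ℕ.+ k ℕ.* suc n) _))
  head : β-term k 0 ≈ v k [mod suc k ]
  head rewrite ℕₚ.*-zeroʳ k | ℕₚ.+-identityʳ k = mod-trans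
    (mod-*ˢ (mod-reflexive q^0) (mod-*ˢ (mod-reflexive 1⁻¹) (mod-*ˢ mod-refl (G-limit k))))
    (mod-reflexive (solve 1 (λ v → con (+ 1) :* (con (+ 1) :* (v :* con (+ 1))) := v) ≈-refl (v k)))

Θ : ℕ → Series
Θ k = const (+ 2) *ˢ Z k -ˢ β k

Θ-constant : ∀ k → Θ 0 ≈ Θ k
Θ-constant zero    = ≈-refl
Θ-constant (suc k) = ≈-trans (Θ-constant k) (begin
  const (+ 2) *ˢ Z k -ˢ β k
    ≈⟨ +ˢ-cong (*ˢ-cong ≈-refl (Z-suc k)) (-ˢ-cong (β-suc k)) ⟩
  const (+ 2) *ˢ (Z (suc k) +ˢ D) -ˢ (β (suc k) +ˢ const (+ 2) *ˢ D)
    ≈⟨ solve 3 (λ z b d → con (+ 2) :* (z :+ d) :- (b :+ con (+ 2) :* d) := con (+ 2) :* z :- b)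
         ≈-refl (Z (suc k)) (β (suc k)) D ⟩
  Θ (suc k) ∎)
  where D = v k *ˢ (G k -ˢ G (suc k))

-- The modulus is `q^k` and not `q^(k+1)`, because the part `q^k χ_k G_(k+1)` of `Z k` is discarded
-- for its factor `q^k` alone.
Θ-limit : ∀ k → Θ k ≈ const (+ 2) *ˢ (ϑ *ˢ v∞) -ˢ v∞ [mod k ]
Θ-limit k = mod-+ˢ (mod-*ˢ mod-refl Z-limit) (mod--ˢ (mod-≤ (ℕₚ.n≤1+n k) (β-limit k)))
  where
  Z-limit : Z k ≈ ϑ *ˢ v∞ [mod k ]
  Z-limit = mod-trans
    (mod-+ˢ (mod-*ˢ (mod-≤ (ℕₚ.n≤1+n k) (Xₖ-limit k)) (mod-≤ (ℕₚ.n≤1+n k) (G-limit k)))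
      (mod--ˢ (mod-*ˢ-zeroˡ _ (q^-*-small _ ℕₚ.≤-refl))))
    (mod-reflexive (solve 1 (λ x → x :* con (+ 1) :- con (+ 0) := x) ≈-refl (ϑ *ˢ v∞)))

main-identity : const (+ 2) *ˢ Z 0 -ˢ β 0 ≈ (const (+ 2) *ˢ ϑ -ˢ 1s) *ˢ v∞
main-identity = ≈-trans (mod⇒≈ (λ k → mod-trans (mod-reflexive (Θ-constant k)) (Θ-limit k)))
  (solve 2 (λ t v → con (+ 2) :* (t :* v) :- v := (con (+ 2) :* t :- con (+ 1)) :* v) ≈-refl ϑ v∞)

-- Rogers–Ramanujan sums

-- Equals `r(r-1)/2`, defined without division.
tri : ℕ → ℕ
tri zero    = 0
tri (suc r) = tri r ℕ.+ r

∏-shift : ∀ n F → ∏ (suc n) F ≈ F 0 *ˢ ∏ n (λ i → F (suc i))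
∏-shift zero    F = *ˢ-comm 1s (F 0)
∏-shift (suc n) F = ≈-trans (*ˢ-cong (∏-shift n F) ≈-refl) (*ˢ-assoc (F 0) _ _)

pr : ℕ → ℕ → Series
pr r k = ∏ k (λ i → 1s -ˢ q^ (suc (r ℕ.+ i)))

pr-shift : ∀ r k → pr r (suc k) ≈ (1s -ˢ q^ (suc r)) *ˢ pr (suc r) k
pr-shift r k = ≈-trans (∏-shift k (λ i → 1s -ˢ q^ (suc (r ℕ.+ i))))
  (*ˢ-cong (+ˢ-cong ≈-refl (-ˢ-cong (q^-cong (cong suc (ℕₚ.+-identityʳ r)))))
    (∏-cong (λ i → +ˢ-cong ≈-refl (-ˢ-cong (q^-cong (cong suc (ℕₚ.+-suc r i))))) k))

-- S k is the classical numerator (q)_∞ G_k = Σ_r (-1)^r q^(2kr+r(5r-1)/2) (1 - q^(k+2r)) (q^(r+1))_{k-1},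
-- rearranged so that no (q)_{k-1} occurs and k = 0 needs no special treatment.
S-exponent : ℕ → ℕ → ℕ
S-exponent k r = 2 ℕ.* (k ℕ.* r) ℕ.+ (5 ℕ.* tri r ℕ.+ 2 ℕ.* r)

-- Write `1 - q^(k+2r) = (1 - q^(k+r)) + q^(k+r) (1 -
-- q^r)`. The first part completes `(q^(r+1))_(k-1)` to `(q^(r+1))_k`, which is `pr r
-- k`; the second completes it to `(q^r)_k` and vanishes at `r = 0`. Renumbering the second part by
-- one, it too carries `pr r k`, with opposite sign and the extra exponent `(2k + 5r + 2) + (k + r +
-- 1) = 3k + 6r + 3`.
S-term : ℕ → ℕ → Series
S-term k r = const (sgn r) *ˢ (q^ (S-exponent k r) *ˢ
  (pr r k *ˢ (1s -ˢ q^ (3 ℕ.* k ℕ.+ 6 ℕ.* r ℕ.+ 3))))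

S : ℕ → Series
S k = Σ∞ (S-term k)

S-exponent-≥ : ∀ k r → r ≤ S-exponent k r
S-exponent-≥ k r = ℕₚ.≤-trans (ℕₚ.m≤m+n r _) (ℕₚ.≤-trans (ℕₚ.m≤n+m (2 ℕ.* r) (5 ℕ.* tri r)) (ℕₚ.m≤n+m _ (2 ℕ.* (k ℕ.* r))))

S-summable : ∀ k → Summable (S-term k)
S-summable k r = mod-*ˢ-zeroʳ _ (q^-*-small _ (S-exponent-≥ k r))

-- Creative telescoping in `r`: the recurrence holds for the summands up to `T r -ˢ T (suc r)`, and
-- `T 0` vanishes because of its factor `1 - q^r`.
S-rec : ∀ k → S k ≈ S (suc k) +ˢ q^ (suc k) *ˢ S (suc (suc k))
S-rec k = begin
  S k
    ≈⟨ solve 2 (λ x y → x := y :+ (x :- y)) ≈-refl (S k) R ⟩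
  R +ˢ (S k -ˢ R)
    ≈⟨ +ˢ-cong ≈-refl (+ˢ-cong ≈-refl (-ˢ-cong R-sum)) ⟨
  R +ˢ (S k -ˢ Σ∞ R-term)
    ≈⟨ +ˢ-cong ≈-refl (Σ∞-- (S-term k) R-term) ⟨
  R +ˢ Σ∞ (λ r → S-term k r -ˢ R-term r)
    ≈⟨ +ˢ-cong ≈-refl (≈-trans (Σ∞-cong step) (Σ∞-telescope T-summable)) ⟩
  R +ˢ T 0
    ≈⟨ +ˢ-cong ≈-refl T-zero ⟩
  R +ˢ 0s
    ≈⟨ +ˢ-identityʳ R ⟩
  R ∎
  where
  R = S (suc k) +ˢ q^ (suc k) *ˢ S (suc (suc k))
  R-term : ℕ → Series
  R-term r = S-term (suc k) r +ˢ q^ (suc k) *ˢ S-term (suc (suc k)) r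
  R-sum : Σ∞ R-term ≈ R
  R-sum = ≈-trans (Σ∞-+ _ _) (+ˢ-cong ≈-refl (≈-sym (*-Σ∞ (q^ (suc k)) (S-summable (suc (suc k))))))
  a = q^ k
  Q = q^ 1
  -- With t = q^r and the ansatz T r ∝ (1 - t) c(t), comparing coefficients of t determines c.
  c : Series → Series
  c t = 1s +ˢ t +ˢ a *ˢ Q *ˢ t ^ 3 +ˢ a ^ 2 *ˢ Q ^ 3 *ˢ t ^ 5 -ˢ a ^ 3 *ˢ Q ^ 4 *ˢ t ^ 6
  T : ℕ → Series
  T r = const (sgn r) *ˢ (q^ (S-exponent k r) *ˢ (pr r k *ˢ ((1s -ˢ q^ r) *ˢ c (q^ r))))
  T-summable : Summable T
  T-summable r = mod-*ˢ-zeroʳ _ (q^-*-small _ (S-exponent-≥ k r))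
  T-zero : T 0 ≈ 0s
  T-zero = ≈-trans
    (*ˢ-cong ≈-refl (*ˢ-cong ≈-refl (*ˢ-cong ≈-refl (*ˢ-cong (+ˢ-cong ≈-refl (-ˢ-cong q^0)) ≈-refl))))
    (solve 4 (λ s e p c → s :* (e :* (p :* ((con (+ 1) :- con (+ 1)) :* c))) := con (+ 0)) ≈-refl _ _ _ _)
  step : ∀ r → S-term k r -ˢ R-term r ≈ T r -ˢ T (suc r)
  step r = begin
    S-term k r -ˢ R-term r
      ≈⟨ +ˢ-cong (*ˢ-cong ≈-refl (*ˢ-cong ≈-refl (*ˢ-cong ≈-refl (+ˢ-cong ≈-refl (-ˢ-cong e₀)))))
          (-ˢ-cong (+ˢ-cong
            (*ˢ-cong ≈-refl (*ˢ-cong E₁ (*ˢ-cong p₁ (+ˢ-cong ≈-refl (-ˢ-cong e₁)))))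
            (*ˢ-cong f₀ (*ˢ-cong ≈-refl (*ˢ-cong E₂ (*ˢ-cong p₂ (+ˢ-cong ≈-refl (-ˢ-cong e₂)))))))) ⟩
    _
      ≈⟨ solve 6 (λ s E P a t Q →
           let mono i j l = a :^ i :* t :^ j :* Q :^ l
               one = con (+ 1)
               p₁ = P :* (one :- mono 1 1 1)
               p₂ = p₁ :* (one :- mono 1 1 2)
               c  = one :+ t :+ a :* Q :* t :^ 3 :+ a :^ 2 :* Q :^ 3 :* t :^ 5 :- a :^ 3 :* Q :^ 4 :* t :^ 6
               tQ = mono 0 1 1
               c′ = one :+ tQ :+ a :* Q :* tQ :^ 3 :+ a :^ 2 :* Q :^ 3 :* tQ :^ 5 :- a :^ 3 :* Q :^ 4 :* tQ :^ 6
           in s :* (E :* (P :* (one :- mono 3 6 3))) :-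
              (s :* (E :* mono 0 2 0 :* (p₁ :* (one :- mono 3 6 6))) :+
               mono 1 0 1 :* (s :* (E :* mono 0 4 0 :* (p₂ :* (one :- mono 3 6 9))))) :=
              s :* (E :* (P :* ((one :- t) :* c))) :-
              (:- s) :* (E :* mono 2 5 2 :* (p₁ :* c′)))
         ≈-refl (const (sgn r)) (q^ (S-exponent k r)) (pr r k) a t Q ⟩
    _
      ≈⟨ +ˢ-cong ≈-refl (-ˢ-cong (*ˢ-cong (const-neg (sgn r)) (*ˢ-cong E₃ last))) ⟨
    T r -ˢ T (suc r) ∎
    where
    t = q^ r
    tQ : q^ (suc r) ≈ a ^ 0 *ˢ t ^ 1 *ˢ Q ^ 1
    tQ = q^-monomial k r 0 1 1 (eq r)
      where
      eq : ∀ r → suc r ≡ 0 ℕ.* k ℕ.+ 1 ℕ.* r ℕ.+ 1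
      eq = solve-∀
    e₀ : q^ (3 ℕ.* k ℕ.+ 6 ℕ.* r ℕ.+ 3) ≈ a ^ 3 *ˢ t ^ 6 *ˢ Q ^ 3
    e₀ = q^-monomial k r 3 6 3 refl
    e₁ : q^ (3 ℕ.* suc k ℕ.+ 6 ℕ.* r ℕ.+ 3) ≈ a ^ 3 *ˢ t ^ 6 *ˢ Q ^ 6
    e₁ = q^-monomial k r 3 6 6 (eq k r)
      where
      eq : ∀ k r → 3 ℕ.* suc k ℕ.+ 6 ℕ.* r ℕ.+ 3 ≡ 3 ℕ.* k ℕ.+ 6 ℕ.* r ℕ.+ 6
      eq = solve-∀
    e₂ : q^ (3 ℕ.* suc (suc k) ℕ.+ 6 ℕ.* r ℕ.+ 3) ≈ a ^ 3 *ˢ t ^ 6 *ˢ Q ^ 9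
    e₂ = q^-monomial k r 3 6 9 (eq k r)
      where
      eq : ∀ k r → 3 ℕ.* suc (suc k) ℕ.+ 6 ℕ.* r ℕ.+ 3 ≡ 3 ℕ.* k ℕ.+ 6 ℕ.* r ℕ.+ 9
      eq = solve-∀
    f₀ : q^ (suc k) ≈ a ^ 1 *ˢ t ^ 0 *ˢ Q ^ 1
    f₀ = q^-monomial k r 1 0 1 (eq k)
      where
      eq : ∀ k → suc k ≡ 1 ℕ.* k ℕ.+ 0 ℕ.* r ℕ.+ 1
      eq = solve-∀
    f₁ : q^ (suc (r ℕ.+ k)) ≈ a ^ 1 *ˢ t ^ 1 *ˢ Q ^ 1
    f₁ = q^-monomial k r 1 1 1 (eq k r)
      where
      eq : ∀ k r → suc (r ℕ.+ k) ≡ 1 ℕ.* k ℕ.+ 1 ℕ.* r ℕ.+ 1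
      eq = solve-∀
    f₂ : q^ (suc (r ℕ.+ suc k)) ≈ a ^ 1 *ˢ t ^ 1 *ˢ Q ^ 2
    f₂ = q^-monomial k r 1 1 2 (eq k r)
      where
      eq : ∀ k r → suc (r ℕ.+ suc k) ≡ 1 ℕ.* k ℕ.+ 1 ℕ.* r ℕ.+ 2
      eq = solve-∀
    p₁ : pr r (suc k) ≈ pr r k *ˢ (1s -ˢ a ^ 1 *ˢ t ^ 1 *ˢ Q ^ 1)
    p₁ = *ˢ-cong ≈-refl (+ˢ-cong ≈-refl (-ˢ-cong f₁))
    p₂ : pr r (suc (suc k)) ≈ pr r k *ˢ (1s -ˢ a ^ 1 *ˢ t ^ 1 *ˢ Q ^ 1) *ˢ (1s -ˢ a ^ 1 *ˢ t ^ 1 *ˢ Q ^ 2)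
    p₂ = *ˢ-cong p₁ (+ˢ-cong ≈-refl (-ˢ-cong f₂))
    shift : ∀ i j l {e} → e ≡ S-exponent k r ℕ.+ (i ℕ.* k ℕ.+ j ℕ.* r ℕ.+ l ℕ.* 1) →
      q^ e ≈ q^ (S-exponent k r) *ˢ (a ^ i *ˢ t ^ j *ˢ Q ^ l)
    shift i j l eq = ≈-trans (q^-split (S-exponent k r) _ eq) (*ˢ-cong ≈-refl (q^-monomial k r i j l refl))
    E₁ : q^ (S-exponent (suc k) r) ≈ q^ (S-exponent k r) *ˢ (a ^ 0 *ˢ t ^ 2 *ˢ Q ^ 0)
    E₁ = shift 0 2 0 (eq k r (tri r))
      where
      eq : ∀ k r x → 2 ℕ.* (suc k ℕ.* r) ℕ.+ (5 ℕ.* x ℕ.+ 2 ℕ.* r) ≡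
        2 ℕ.* (k ℕ.* r) ℕ.+ (5 ℕ.* x ℕ.+ 2 ℕ.* r) ℕ.+ (0 ℕ.* k ℕ.+ 2 ℕ.* r ℕ.+ 0)
      eq = solve-∀
    E₂ : q^ (S-exponent (suc (suc k)) r) ≈ q^ (S-exponent k r) *ˢ (a ^ 0 *ˢ t ^ 4 *ˢ Q ^ 0)
    E₂ = shift 0 4 0 (eq k r (tri r))
      where
      eq : ∀ k r x → 2 ℕ.* (suc (suc k) ℕ.* r) ℕ.+ (5 ℕ.* x ℕ.+ 2 ℕ.* r) ≡
        2 ℕ.* (k ℕ.* r) ℕ.+ (5 ℕ.* x ℕ.+ 2 ℕ.* r) ℕ.+ (0 ℕ.* k ℕ.+ 4 ℕ.* r ℕ.+ 0)
      eq = solve-∀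
    E₃ : q^ (S-exponent k (suc r)) ≈ q^ (S-exponent k r) *ˢ (a ^ 2 *ˢ t ^ 5 *ˢ Q ^ 2)
    E₃ = shift 2 5 2 (eq k r (tri r))
      where
      eq : ∀ k r x → 2 ℕ.* (k ℕ.* suc r) ℕ.+ (5 ℕ.* (x ℕ.+ r) ℕ.+ 2 ℕ.* suc r) ≡
        2 ℕ.* (k ℕ.* r) ℕ.+ (5 ℕ.* x ℕ.+ 2 ℕ.* r) ℕ.+ (2 ℕ.* k ℕ.+ 5 ℕ.* r ℕ.+ 2)
      eq = solve-∀
    t′ = a ^ 0 *ˢ t ^ 1 *ˢ Q ^ 1
    ^-cong : ∀ n {x y} → x ≈ y → x ^ n ≈ y ^ n
    ^-cong zero    e = ≈-refl
    ^-cong (suc n) e = *ˢ-cong e (^-cong n e)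
    -- The factor `1 - q^(r+1)` of `T (suc r)` extends `pr (suc r) k` downwards to `pr r (suc k)`;
    -- thereby every product in the step is a multiple of `pr r k`.
    last : pr (suc r) k *ˢ ((1s -ˢ q^ (suc r)) *ˢ c (q^ (suc r))) ≈
           pr r k *ˢ (1s -ˢ a ^ 1 *ˢ t ^ 1 *ˢ Q ^ 1) *ˢ c t′
    last = begin
      pr (suc r) k *ˢ ((1s -ˢ q^ (suc r)) *ˢ c (q^ (suc r)))
        ≈⟨ solve 3 (λ p o c → p :* (o :* c) := (o :* p) :* c) ≈-refl _ _ _ ⟩
      (1s -ˢ q^ (suc r)) *ˢ pr (suc r) k *ˢ c (q^ (suc r))
        ≈⟨ *ˢ-cong (≈-trans (≈-sym (pr-shift r k)) p₁)
             (+ˢ-cong (+ˢ-cong (+ˢ-cong (+ˢ-cong ≈-refl tQ) (*ˢ-cong ≈-refl (^-cong 3 tQ)))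
               (*ˢ-cong ≈-refl (^-cong 5 tQ))) (-ˢ-cong (*ˢ-cong ≈-refl (^-cong 6 tQ)))) ⟩
      pr r k *ˢ (1s -ˢ a ^ 1 *ˢ t ^ 1 *ˢ Q ^ 1) *ˢ c t′ ∎

S-limit : ∀ k → S k ≈ p∞ [mod suc k ]
S-limit k = mod-trans (Σ∞-head (S-summable k) small) (mod-trans head
    (mod-sym (∏∞-limit (1-q^-multipliable suc (λ _ → ℕₚ.≤-refl)) k)))
  where
  small : ∀ r → S-term k (suc r) ≈ 0s [mod suc k ]
  small r = mod-*ˢ-zeroʳ _ (q^-*-small _ (subst (_≤ S-exponent k (suc r)) (ℕₚ.+-comm k 1)
    (ℕₚ.+-mono-≤ (ℕₚ.≤-trans (ℕₚ.m≤m*n k (suc r)) (ℕₚ.m≤m+n _ _))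
      (ℕₚ.≤-trans (s≤s z≤n) (ℕₚ.m≤n+m (2 ℕ.* suc r) (5 ℕ.* tri (suc r)))))))
  head : S-term k 0 ≈ p k [mod suc k ]
  head = mod-trans
    (mod-*ˢ mod-refl (mod-*ˢ
      (mod-reflexive (≈-trans (q^-cong (cong (λ x → 2 ℕ.* x ℕ.+ 0) (ℕₚ.*-zeroʳ k))) q^0))
      (mod-*ˢ mod-refl (mod-+ˢ mod-refl (mod--ˢ (q^-small big))))))
    (mod-reflexive (solve 1 (λ p → con (+ 1) :* (con (+ 1) :* (p :* (con (+ 1) :- con (+ 0)))) := p) ≈-refl (p k)))
    where
    big : suc k ≤ 3 ℕ.* k ℕ.+ 0 ℕ.+ 3
    big = subst (_≤ 3 ℕ.* k ℕ.+ 0 ℕ.+ 3) (ℕₚ.+-comm k 1)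
      (ℕₚ.+-mono-≤ (ℕₚ.≤-trans (ℕₚ.m≤m+n k _) (ℕₚ.m≤m+n _ 0)) (s≤s z≤n))

-- Unrolling the recurrence `d` times expresses `h k` through values of index at least `k + d`, all
-- of which vanish modulo `q^(k+d)`; and `d` is arbitrary.
recessive-zero : ∀ (h : ℕ → Series) → (∀ k → h k ≈ h (suc k) +ˢ q^ (suc k) *ˢ h (suc (suc k))) →
  (∀ k → h k ≈ 0s [mod k ]) → ∀ k → h k ≈ 0s
recessive-zero h rec lim k = mod⇒≈ (λ n → go n k (ℕₚ.m≤n+m n k))
  where
  go : ∀ {n} d k → n ≤ k ℕ.+ d → h k ≈ 0s [mod n ]
  go {n} zero    k n≤k = mod-≤ (subst (n ≤_) (ℕₚ.+-identityʳ k) n≤k) (lim k)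
  go {n} (suc d) k n≤k = mod-trans (mod-reflexive (rec k)) (mod-trans
    (mod-+ˢ (go d (suc k) n≤) (mod-*ˢ-zeroʳ _ (go d (suc (suc k)) (ℕₚ.m≤n⇒m≤1+n n≤))))
    (mod-reflexive (+ˢ-identityʳ 0s)))
    where
    n≤ : n ≤ suc k ℕ.+ d
    n≤ = subst (n ≤_) (ℕₚ.+-suc k d) n≤k

-- Both sides satisfy the recurrence of `G` and agree with `(q)_∞` modulo `q^(k+1)`, so their
-- difference falls under `recessive-zero`.
p∞-G : ∀ k → p∞ *ˢ G k ≈ S k
p∞-G k = begin
  p∞ *ˢ G k                        ≈⟨ solve 2 (λ x y → x := (x :- y) :+ y) ≈-refl _ (S k) ⟩
  (p∞ *ˢ G k -ˢ S k) +ˢ S k        ≈⟨ +ˢ-cong (recessive-zero h h-rec h-limit k) ≈-refl ⟩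
  0s +ˢ S k                        ≈⟨ solve 1 (λ x → con (+ 0) :+ x := x) ≈-refl (S k) ⟩
  S k                              ∎
  where
  h : ℕ → Series
  h k = p∞ *ˢ G k -ˢ S k
  h-rec : ∀ k → h k ≈ h (suc k) +ˢ q^ (suc k) *ˢ h (suc (suc k))
  h-rec k = ≈-trans (+ˢ-cong (*ˢ-cong ≈-refl (G-rec k)) (-ˢ-cong (S-rec k)))
    (solve 6 (λ p g₁ g₂ s₁ s₂ q → p :* (g₁ :+ q :* g₂) :- (s₁ :+ q :* s₂) :=
        (p :* g₁ :- s₁) :+ q :* (p :* g₂ :- s₂)) ≈-refl
      p∞ (G (suc k)) (G (suc (suc k))) (S (suc k)) (S (suc (suc k))) (q^ (suc k)))
  h-limit : ∀ k → h k ≈ 0s [mod k ]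
  h-limit k = mod-≤ (ℕₚ.n≤1+n k) (mod-trans
    (mod-+ˢ (mod-*ˢ mod-refl (G-limit k)) (mod--ˢ (S-limit k)))
    (mod-reflexive (solve 1 (λ p → p :* con (+ 1) :- p := con (+ 0)) ≈-refl p∞)))

-- Theta functions

-- The two-sided sum is split at 0: θ⁺ j and θ⁻ j are the terms of index j and -j, where z = q^a and
-- the base is q^b, so that q^b / z = q^a′.
module TripleProduct (α α′ : ℕ) where

  a a′ b : ℕ
  a  = suc α
  a′ = suc α′
  b  = a ℕ.+ a′

  A A′ P W : ℕ → Series
  A  k = ∏ k (λ i → 1s -ˢ q^ (a ℕ.+ b ℕ.* i))
  A′ k = ∏ k (λ i → 1s -ˢ q^ (a′ ℕ.+ b ℕ.* i))
  P  k = ∏ k (λ i → 1s -ˢ q^ (b ℕ.+ b ℕ.* i))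
  W  k = P k ⁻¹

  A∞ A′∞ P∞ W∞ : Series
  A∞  = ∏∞ (λ i → 1s -ˢ q^ (a ℕ.+ b ℕ.* i))
  A′∞ = ∏∞ (λ i → 1s -ˢ q^ (a′ ℕ.+ b ℕ.* i))
  P∞  = ∏∞ (λ i → 1s -ˢ q^ (b ℕ.+ b ℕ.* i))
  W∞  = P∞ ⁻¹

  i<1+c+b*i : ∀ c i → i < suc c ℕ.+ b ℕ.* i
  i<1+c+b*i c i = s≤s (ℕₚ.≤-trans (ℕₚ.m≤n*m i b) (ℕₚ.m≤n+m (b ℕ.* i) c))

  P-constant : ∀ k → P k 0 ≡ + 1
  P-constant = ∏-constant (λ i → 1-q^-constant (α ℕ.+ a′ ℕ.+ b ℕ.* i))

  A-constant : ∀ k → A k 0 ≡ + 1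
  A-constant = ∏-constant (λ i → 1-q^-constant (α ℕ.+ b ℕ.* i))

  A′-constant : ∀ k → A′ k 0 ≡ + 1
  A′-constant = ∏-constant (λ i → 1-q^-constant (α′ ℕ.+ b ℕ.* i))

  W-suc : ∀ k → W k ≈ (1s -ˢ q^ (b ℕ.+ b ℕ.* k)) *ˢ W (suc k)
  W-suc k = ⁻¹-cancel _ (P-constant k) (1-q^-constant (α ℕ.+ a′ ℕ.+ b ℕ.* k))

  W-limit : ∀ k → W k ≈ W∞ [mod suc k ]
  W-limit k = mod-sym (mod-⁻¹ (P-constant 1) (P-constant k)
    (∏∞-limit (1-q^-multipliable _ (i<1+c+b*i (α ℕ.+ a′))) k))

  -- The terms of Euler's expansion of `(q^(a+bk);q^b)_∞`. `euler-suc` strips one factor off the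
  -- product, and what is left tends to 1.
  euler-term : ℕ → ℕ → Series
  euler-term k j = const (sgn j) *ˢ (q^ (b ℕ.* tri j ℕ.+ (a ℕ.+ b ℕ.* k) ℕ.* j) *ˢ W j)

  euler : ℕ → Series
  euler k = Σ∞ (euler-term k)

  a*j-≥ : ∀ k j → j ≤ b ℕ.* tri j ℕ.+ (a ℕ.+ b ℕ.* k) ℕ.* j
  a*j-≥ k j = ℕₚ.≤-trans (ℕₚ.m≤n*m j (a ℕ.+ b ℕ.* k)) (ℕₚ.m≤n+m _ (b ℕ.* tri j))

  euler-summable : ∀ k → Summable (euler-term k)
  euler-summable k j = mod-*ˢ-zeroʳ _ (q^-*-small _ (a*j-≥ k j))

  euler-suc : ∀ k → euler k ≈ (1s -ˢ q^ (a ℕ.+ b ℕ.* k)) *ˢ euler (suc k)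
  euler-suc k = begin
    euler k
      ≈⟨ Σ∞-cong split ⟩
    Σ∞ (λ j → euler-term (suc k) j +ˢ D j)
      ≈⟨ ≈-trans (Σ∞-+ (euler-term (suc k)) D) (+ˢ-cong ≈-refl (Σ∞-shift D-summable)) ⟩
    euler (suc k) +ˢ (D 0 +ˢ Σ∞ (λ j → D (suc j)))
      ≈⟨ +ˢ-cong ≈-refl (+ˢ-cong D-zero (≈-trans (Σ∞-cong D-suc) (≈-sym (*-Σ∞ (-ˢ z) (euler-summable (suc k)))))) ⟩
    euler (suc k) +ˢ (0s +ˢ -ˢ z *ˢ euler (suc k))
      ≈⟨ solve 2 (λ z e → e :+ (con (+ 0) :+ :- z :* e) := (con (+ 1) :- z) :* e) ≈-refl z (euler (suc k)) ⟩
    (1s -ˢ z) *ˢ euler (suc k) ∎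
    where
    z = q^ (a ℕ.+ b ℕ.* k)
    E : ℕ → ℕ
    E j = b ℕ.* tri j ℕ.+ (a ℕ.+ b ℕ.* k) ℕ.* j
    D : ℕ → Series
    D j = const (sgn j) *ˢ (q^ (E j) *ˢ ((1s -ˢ q^ (b ℕ.* j)) *ˢ W j))
    D-summable : Summable D
    D-summable j = mod-*ˢ-zeroʳ _ (q^-*-small _ (a*j-≥ k j))
    split : ∀ j → euler-term k j ≈ euler-term (suc k) j +ˢ D j
    split j = begin
      euler-term k j
        ≈⟨ solve 4 (λ s e u w → s :* (e :* w) := s :* (e :* u :* w) :+ s :* (e :* ((con (+ 1) :- u) :* w)))
             ≈-refl _ (q^ (E j)) (q^ (b ℕ.* j)) (W j) ⟩
      const (sgn j) *ˢ (q^ (E j) *ˢ q^ (b ℕ.* j) *ˢ W j) +ˢ D j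
        ≈⟨ +ˢ-cong (*ˢ-cong ≈-refl (*ˢ-cong (q^-split (E j) (b ℕ.* j) (eq a b k j (tri j))) ≈-refl)) ≈-refl ⟨
      euler-term (suc k) j +ˢ D j ∎
      where
      eq : ∀ a b k j x → b ℕ.* x ℕ.+ (a ℕ.+ b ℕ.* suc k) ℕ.* j ≡ b ℕ.* x ℕ.+ (a ℕ.+ b ℕ.* k) ℕ.* j ℕ.+ b ℕ.* j
      eq = solve-∀
    D-zero : D 0 ≈ 0s
    D-zero = ≈-trans
      (*ˢ-cong ≈-refl (*ˢ-cong ≈-refl (*ˢ-cong (+ˢ-cong ≈-refl (-ˢ-cong (≈-trans (q^-cong (ℕₚ.*-zeroʳ b)) q^0))) ≈-refl)))
      (solve 3 (λ s e w → s :* (e :* ((con (+ 1) :- con (+ 1)) :* w)) := con (+ 0)) ≈-refl _ _ _)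
    D-suc : ∀ j → D (suc j) ≈ -ˢ z *ˢ euler-term (suc k) j
    D-suc j = begin
      const (- sgn j) *ˢ (q^ (E (suc j)) *ˢ ((1s -ˢ q^ (b ℕ.* suc j)) *ˢ W (suc j)))
        ≈⟨ *ˢ-cong (const-neg (sgn j)) (*ˢ-cong (q^-split (a ℕ.+ b ℕ.* k) _ (eq a b k j (tri j)))
             (≈-trans (*ˢ-cong (+ˢ-cong ≈-refl (-ˢ-cong (q^-cong (ℕₚ.*-suc b j)))) ≈-refl) (≈-sym (W-suc j)))) ⟩
      -ˢ const (sgn j) *ˢ ((z *ˢ q^ (b ℕ.* tri j ℕ.+ (a ℕ.+ b ℕ.* suc k) ℕ.* j)) *ˢ W j)
        ≈⟨ solve 4 (λ s z e w → :- s :* ((z :* e) :* w) := :- z :* (s :* (e :* w))) ≈-refl _ z _ (W j) ⟩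
      -ˢ z *ˢ euler-term (suc k) j ∎
      where
      eq : ∀ a b k j x → b ℕ.* (x ℕ.+ j) ℕ.+ (a ℕ.+ b ℕ.* k) ℕ.* suc j ≡
        a ℕ.+ b ℕ.* k ℕ.+ (b ℕ.* x ℕ.+ (a ℕ.+ b ℕ.* suc k) ℕ.* j)
      eq = solve-∀

  euler-product : ∀ k → euler 0 ≈ A k *ˢ euler k
  euler-product zero    = ≈-sym (*ˢ-identityˡ (euler 0))
  euler-product (suc k) = ≈-trans (euler-product k)
    (≈-trans (*ˢ-cong ≈-refl (euler-suc k)) (≈-sym (*ˢ-assoc (A k) _ _)))

  euler-head : ∀ k → euler-term k 0 ≈ 1s
  euler-head k = begin
    1s *ˢ (q^ (b ℕ.* 0 ℕ.+ (a ℕ.+ b ℕ.* k) ℕ.* 0) *ˢ W 0)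
      ≈⟨ *ˢ-cong ≈-refl (*ˢ-cong (≈-trans (q^-cong (cong₂ ℕ._+_ (ℕₚ.*-zeroʳ b) (ℕₚ.*-zeroʳ (a ℕ.+ b ℕ.* k)))) q^0) 1⁻¹) ⟩
    1s *ˢ (1s *ˢ 1s)
      ≈⟨ solve 0 (con (+ 1) :* (con (+ 1) :* con (+ 1)) := con (+ 1)) ≈-refl ⟩
    1s ∎

  euler-limit : ∀ k → euler k ≈ 1s [mod suc k ]
  euler-limit k = mod-trans
    (Σ∞-head (euler-summable k) (λ j → mod-*ˢ-zeroʳ _ (q^-*-small _ (ℕₚ.≤-trans (i<1+c+b*i α k)
      (ℕₚ.≤-trans (ℕₚ.m≤m*n (a ℕ.+ b ℕ.* k) (suc j)) (ℕₚ.m≤n+m _ (b ℕ.* tri (suc j))))))))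
    (mod-reflexive (euler-head k))

  euler≈A∞ : euler 0 ≈ A∞
  euler≈A∞ = mod⇒≈ (λ n → mod-≤ (ℕₚ.n≤1+n n) (mod-trans (mod-reflexive (euler-product n))
    (mod-trans (mod-*ˢ mod-refl (euler-limit n)) (mod-trans
      (mod-reflexive (≈-trans (*ˢ-comm (A n) 1s) (*ˢ-identityˡ (A n))))
      (mod-sym (∏∞-limit (1-q^-multipliable _ (i<1+c+b*i α)) n))))))

  -- W (N - j), with the convention W n = 0 for n < 0
  U : ℕ → ℕ → Series
  U N       zero    = W N
  U zero    (suc j) = 0s
  U (suc N) (suc j) = U N j

  θ⁺ θ⁻ : ℕ → Series
  θ⁺ j = q^ (b ℕ.* tri j ℕ.+ a ℕ.* j)
  θ⁻ j = q^ (b ℕ.* tri j ℕ.+ a′ ℕ.* j)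

  θ-≥ : ∀ c j → j ≤ b ℕ.* tri j ℕ.+ suc c ℕ.* j
  θ-≥ c j = ℕₚ.≤-trans (ℕₚ.m≤n*m j (suc c)) (ℕₚ.m≤n+m _ (b ℕ.* tri j))

  F⁺-term F⁻-term : ℕ → ℕ → Series
  F⁺-term N j = const (sgn j) *ˢ (θ⁺ j *ˢ W (N ℕ.+ j))
  F⁻-term N j = const (sgn (suc j)) *ˢ (θ⁻ (suc j) *ˢ U N (suc j))

  -- The theta series with the term of index `j ∈ ℤ` weighted by `W (N + j)`, which is zero for
  -- `N + j < 0`. It interpolates between Euler's series at `N = 0`, where no negative index
  -- survives, and `W∞ *ˢ theta` as `N` grows. Each step in `N` contributes one factor of `A′`.
  F : ℕ → Series
  F N = Σ∞ (F⁺-term N) +ˢ Σ∞ (F⁻-term N)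

  F⁺-summable : ∀ N → Summable (F⁺-term N)
  F⁺-summable N j = mod-*ˢ-zeroʳ _ (q^-*-small _ (θ-≥ α j))

  U-suc : ∀ N j → θ⁻ (suc j) *ˢ U (suc N) (suc j) ≈
    θ⁻ (suc j) *ˢ U N (suc j) +ˢ q^ (a′ ℕ.+ b ℕ.* N) *ˢ (θ⁻ j *ˢ U N j)
  U-suc N j = begin
    θ⁻ (suc j) *ˢ U N j
      ≈⟨ go N j ⟩
    θ⁻ (suc j) *ˢ U N (suc j) +ˢ θ⁻ (suc j) *ˢ (q^ (b ℕ.* (N ∸ j)) *ˢ U N j)
      ≈⟨ +ˢ-cong ≈-refl (weight N j) ⟩
    θ⁻ (suc j) *ˢ U N (suc j) +ˢ q^ (a′ ℕ.+ b ℕ.* N) *ˢ (θ⁻ j *ˢ U N j) ∎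
    where
    -- This is `W (n - 1) = (1 - q^(bn)) W n` at `n = N - j`. It persists at `n = 0` as
    -- `W (-1) = 0`, and for `N < j` all terms vanish, so truncated subtraction does no harm.
    rec : ∀ N j → U N j ≈ U N (suc j) +ˢ q^ (b ℕ.* (N ∸ j)) *ˢ U N j
    rec zero    zero    = ≈-trans (solve 1 (λ w → w := con (+ 0) :+ con (+ 1) :* w) ≈-refl _)
      (+ˢ-cong ≈-refl (*ˢ-cong (≈-sym (≈-trans (q^-cong (ℕₚ.*-zeroʳ b)) q^0)) ≈-refl))
    rec (suc N) zero    = ≈-trans (solve 2 (λ w u → w := (con (+ 1) :- u) :* w :+ u :* w) ≈-refl (W (suc N)) (q^ (b ℕ.* suc N)))
      (+ˢ-cong (≈-trans (*ˢ-cong (+ˢ-cong ≈-refl (-ˢ-cong (q^-cong (ℕₚ.*-suc b N)))) ≈-refl) (≈-sym (W-suc N))) ≈-refl)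
    rec zero    (suc j) = solve 1 (λ u → con (+ 0) := con (+ 0) :+ u :* con (+ 0)) ≈-refl _
    rec (suc N) (suc j) = rec N j
    go : ∀ N j → θ⁻ (suc j) *ˢ U N j ≈
      θ⁻ (suc j) *ˢ U N (suc j) +ˢ θ⁻ (suc j) *ˢ (q^ (b ℕ.* (N ∸ j)) *ˢ U N j)
    go N j = ≈-trans (*ˢ-cong ≈-refl (rec N j))
      (solve 3 (λ t x y → t :* (x :+ y) := t :* x :+ t :* y) ≈-refl _ _ _)
    vanish : ∀ {N j} → N < j → U N j ≈ 0s
    vanish {zero}  {suc j} _         = ≈-refl
    vanish {suc N} {suc j} (s≤s N<j) = vanish N<j
    weight : ∀ N j → θ⁻ (suc j) *ˢ (q^ (b ℕ.* (N ∸ j)) *ˢ U N j) ≈ q^ (a′ ℕ.+ b ℕ.* N) *ˢ (θ⁻ j *ˢ U N j)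
    weight N j with ℕₚ.≤-<-connex j N
    ... | inj₂ N<j = ≈-trans (*ˢ-cong ≈-refl (*ˢ-cong ≈-refl (vanish N<j)))
      (≈-trans (solve 4 (λ x y z t → x :* (y :* con (+ 0)) := z :* (t :* con (+ 0))) ≈-refl _ _ _ _)
        (*ˢ-cong ≈-refl (*ˢ-cong ≈-refl (≈-sym (vanish N<j)))))
    ... | inj₁ j≤N = begin
      θ⁻ (suc j) *ˢ (q^ (b ℕ.* d) *ˢ U N j)     ≈⟨ *ˢ-assoc _ _ _ ⟨
      θ⁻ (suc j) *ˢ q^ (b ℕ.* d) *ˢ U N j       ≈⟨ *ˢ-cong (q^-+ (b ℕ.* tri (suc j) ℕ.+ a′ ℕ.* suc j) (b ℕ.* d)) ≈-refl ⟨
      q^ (b ℕ.* tri (suc j) ℕ.+ a′ ℕ.* suc j ℕ.+ b ℕ.* d) *ˢ U N j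
        ≈⟨ *ˢ-cong (q^-split (a′ ℕ.+ b ℕ.* N) (b ℕ.* tri j ℕ.+ a′ ℕ.* j)
             (trans (eq a′ b j d (tri j)) (cong (λ x → a′ ℕ.+ b ℕ.* x ℕ.+ (b ℕ.* tri j ℕ.+ a′ ℕ.* j)) (ℕₚ.m+[n∸m]≡n j≤N)))) ≈-refl ⟩
      q^ (a′ ℕ.+ b ℕ.* N) *ˢ θ⁻ j *ˢ U N j      ≈⟨ *ˢ-assoc _ _ _ ⟩
      q^ (a′ ℕ.+ b ℕ.* N) *ˢ (θ⁻ j *ˢ U N j)    ∎
      where
      d = N ∸ j
      eq : ∀ a b j d x → b ℕ.* (x ℕ.+ j) ℕ.+ a ℕ.* suc j ℕ.+ b ℕ.* d ≡ a ℕ.+ b ℕ.* (j ℕ.+ d) ℕ.+ (b ℕ.* x ℕ.+ a ℕ.* j)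
      eq = solve-∀

  -- Passing from `N` to `N + 1` subtracts `y` times the series shifted by one index. The
  -- nonnegative half loses its term of index 0 in the shift; the negative half, shifted into `H`,
  -- gains exactly this term (`H-zero`). Together they restore `y *ˢ F N`.
  F-suc : ∀ N → F (suc N) ≈ (1s -ˢ q^ (a′ ℕ.+ b ℕ.* N)) *ˢ F N
  F-suc N = begin
    Σ∞ (F⁺-term (suc N)) +ˢ Σ∞ (F⁻-term (suc N))
      ≈⟨ +ˢ-cong (≈-trans (Σ∞-cong F⁺-step) (≈-trans (Σ∞-- (F⁺-term N) (λ j → y *ˢ F⁺-term N (suc j)))
             (+ˢ-cong ≈-refl (-ˢ-cong (≈-sym (*-Σ∞ y tail⁺-summable))))))
           (≈-trans (Σ∞-cong F⁻-step) (≈-trans (Σ∞-- (F⁻-term N) (λ j → y *ˢ H j))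
             (+ˢ-cong ≈-refl (-ˢ-cong (≈-sym (*-Σ∞ y H-summable)))))) ⟩
    (Σ∞ (F⁺-term N) -ˢ y *ˢ Σ∞ (λ j → F⁺-term N (suc j))) +ˢ (Σ∞ (F⁻-term N) -ˢ y *ˢ Σ∞ H)
      ≈⟨ +ˢ-cong (+ˢ-cong (Σ∞-shift (F⁺-summable N)) ≈-refl) (+ˢ-cong ≈-refl (-ˢ-cong (*ˢ-cong ≈-refl (Σ∞-shift H-summable)))) ⟩
    ((F⁺-term N 0 +ˢ L) -ˢ y *ˢ L) +ˢ (Σ∞ (F⁻-term N) -ˢ y *ˢ (H 0 +ˢ Σ∞ (F⁻-term N)))
      ≈⟨ +ˢ-cong ≈-refl (+ˢ-cong ≈-refl (-ˢ-cong (*ˢ-cong ≈-refl (+ˢ-cong H-zero ≈-refl)))) ⟩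
    ((F⁺-term N 0 +ˢ L) -ˢ y *ˢ L) +ˢ (Σ∞ (F⁻-term N) -ˢ y *ˢ (F⁺-term N 0 +ˢ Σ∞ (F⁻-term N)))
      ≈⟨ solve 4 (λ f l y g → ((f :+ l) :- y :* l) :+ (g :- y :* (f :+ g)) := (con (+ 1) :- y) :* ((f :+ l) :+ g))
           ≈-refl (F⁺-term N 0) L y (Σ∞ (F⁻-term N)) ⟩
    (1s -ˢ y) *ˢ ((F⁺-term N 0 +ˢ L) +ˢ Σ∞ (F⁻-term N))
      ≈⟨ *ˢ-cong ≈-refl (+ˢ-cong (Σ∞-shift (F⁺-summable N)) ≈-refl) ⟨
    (1s -ˢ y) *ˢ F N ∎
    where
    y = q^ (a′ ℕ.+ b ℕ.* N)
    L = Σ∞ (λ j → F⁺-term N (suc j))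
    H : ℕ → Series
    H j = const (sgn j) *ˢ (θ⁻ j *ˢ U N j)
    H-summable : Summable H
    H-summable j = mod-*ˢ-zeroʳ _ (q^-*-small _ (θ-≥ α′ j))
    tail⁺-summable : Summable (λ j → F⁺-term N (suc j))
    tail⁺-summable j = mod-≤ (ℕₚ.n≤1+n j) (F⁺-summable N (suc j))
    H-zero : H 0 ≈ F⁺-term N 0
    H-zero = *ˢ-cong ≈-refl (*ˢ-cong
      (q^-cong (cong (λ x → b ℕ.* 0 ℕ.+ x) (trans (ℕₚ.*-zeroʳ a′) (sym (ℕₚ.*-zeroʳ a)))))
      (subst (λ x → W N ≈ W x) (sym (ℕₚ.+-identityʳ N)) ≈-refl))
    F⁻-step : ∀ j → F⁻-term (suc N) j ≈ F⁻-term N j -ˢ y *ˢ H j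
    F⁻-step j = begin
      const (- sgn j) *ˢ (θ⁻ (suc j) *ˢ U (suc N) (suc j))
        ≈⟨ *ˢ-cong (const-neg (sgn j)) (U-suc N j) ⟩
      -ˢ const (sgn j) *ˢ (θ⁻ (suc j) *ˢ U N (suc j) +ˢ y *ˢ (θ⁻ j *ˢ U N j))
        ≈⟨ solve 4 (λ s x y h → :- s :* (x :+ y :* h) := :- s :* x :- y :* (s :* h)) ≈-refl _ _ y _ ⟩
      -ˢ const (sgn j) *ˢ (θ⁻ (suc j) *ˢ U N (suc j)) -ˢ y *ˢ H j
        ≈⟨ +ˢ-cong (*ˢ-cong (const-neg (sgn j)) ≈-refl) ≈-refl ⟨
      F⁻-term N j -ˢ y *ˢ H j ∎
    F⁺-step : ∀ j → F⁺-term (suc N) j ≈ F⁺-term N j -ˢ y *ˢ F⁺-term N (suc j)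
    F⁺-step j = begin
      s *ˢ (θ⁺ j *ˢ x)
        ≈⟨ solve 4 (λ s t x u → s :* (t :* x) := s :* (t :* ((con (+ 1) :- u) :* x)) :- (:- s) :* ((t :* u) :* x))
             ≈-refl s (θ⁺ j) x (q^ (b ℕ.+ b ℕ.* (N ℕ.+ j))) ⟩
      s *ˢ (θ⁺ j *ˢ ((1s -ˢ q^ (b ℕ.+ b ℕ.* (N ℕ.+ j))) *ˢ x)) -ˢ
        (-ˢ s) *ˢ ((θ⁺ j *ˢ q^ (b ℕ.+ b ℕ.* (N ℕ.+ j))) *ˢ x)
        ≈⟨ +ˢ-cong (*ˢ-cong ≈-refl (*ˢ-cong ≈-refl (≈-sym (W-suc (N ℕ.+ j)))))
             (-ˢ-cong (*ˢ-cong (≈-sym (const-neg (sgn j))) (*ˢ-cong exponent ≈-refl))) ⟩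
      F⁺-term N j -ˢ const (sgn (suc j)) *ˢ ((y *ˢ θ⁺ (suc j)) *ˢ x)
        ≈⟨ +ˢ-cong ≈-refl (-ˢ-cong (solve 4 (λ s y t x → s :* ((y :* t) :* x) := y :* (s :* (t :* x))) ≈-refl _ y (θ⁺ (suc j)) x)) ⟩
      F⁺-term N j -ˢ y *ˢ (const (sgn (suc j)) *ˢ (θ⁺ (suc j) *ˢ W (suc (N ℕ.+ j))))
        ≡⟨ cong (λ i → F⁺-term N j -ˢ y *ˢ (const (sgn (suc j)) *ˢ (θ⁺ (suc j) *ˢ W i))) (ℕₚ.+-suc N j) ⟨
      F⁺-term N j -ˢ y *ˢ F⁺-term N (suc j) ∎
      where
      s = const (sgn j)
      x = W (suc (N ℕ.+ j))
      eq : ∀ a a′ N j x → let b = a ℕ.+ a′ in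
        b ℕ.* x ℕ.+ a ℕ.* j ℕ.+ (b ℕ.+ b ℕ.* (N ℕ.+ j)) ≡ a′ ℕ.+ b ℕ.* N ℕ.+ (b ℕ.* (x ℕ.+ j) ℕ.+ a ℕ.* suc j)
      eq = solve-∀
      exponent : θ⁺ j *ˢ q^ (b ℕ.+ b ℕ.* (N ℕ.+ j)) ≈ y *ˢ θ⁺ (suc j)
      exponent = ≈-trans (≈-sym (q^-+ (b ℕ.* tri j ℕ.+ a ℕ.* j) (b ℕ.+ b ℕ.* (N ℕ.+ j))))
        (q^-split (a′ ℕ.+ b ℕ.* N) _ (eq a a′ N j (tri j)))

  F-product : ∀ N → F N ≈ A∞ *ˢ A′ N
  F-product zero = begin
    Σ∞ (F⁺-term 0) +ˢ Σ∞ (F⁻-term 0)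
      ≈⟨ +ˢ-cong (Σ∞-cong (λ j → *ˢ-cong ≈-refl (*ˢ-cong (q^-cong
             (cong (λ x → b ℕ.* tri j ℕ.+ x ℕ.* j) (sym (trans (cong (a ℕ.+_) (ℕₚ.*-zeroʳ b)) (ℕₚ.+-identityʳ a))))) ≈-refl)))
           (Σ∞-zero (λ j → solve 2 (λ s t → s :* (t :* con (+ 0)) := con (+ 0)) ≈-refl _ _)) ⟩
    euler 0 +ˢ 0s
      ≈⟨ +ˢ-cong euler≈A∞ ≈-refl ⟩
    A∞ +ˢ 0s
      ≈⟨ solve 1 (λ x → x :+ con (+ 0) := x :* con (+ 1)) ≈-refl A∞ ⟩
    A∞ *ˢ 1s ∎
  F-product (suc N) = begin
    F (suc N)                                     ≈⟨ F-suc N ⟩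
    y *ˢ F N                                      ≈⟨ *ˢ-cong ≈-refl (F-product N) ⟩
    y *ˢ (A∞ *ˢ A′ N)                             ≈⟨ solve 3 (λ y a b → y :* (a :* b) := a :* (b :* y)) ≈-refl y A∞ (A′ N) ⟩
    A∞ *ˢ A′ (suc N)                              ∎
    where y = 1s -ˢ q^ (a′ ℕ.+ b ℕ.* N)

  theta : Series
  theta = Σ∞ (λ j → const (sgn j) *ˢ θ⁺ j) +ˢ Σ∞ (λ j → const (sgn (suc j)) *ˢ θ⁻ (suc j))

  F-limit : ∀ N → F N ≈ W∞ *ˢ theta [mod suc N ]
  F-limit N = mod-trans (mod-+ˢ (Σ∞-mod plus) (Σ∞-mod minus)) (mod-reflexive (begin
    Σ∞ (λ j → W∞ *ˢ (const (sgn j) *ˢ θ⁺ j)) +ˢ Σ∞ (λ j → W∞ *ˢ (const (sgn (suc j)) *ˢ θ⁻ (suc j)))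
      ≈⟨ +ˢ-cong (*-Σ∞ W∞ (λ j → mod-*ˢ-zeroʳ _ (q^-small (θ-≥ α j))))
           (*-Σ∞ W∞ (λ j → mod-*ˢ-zeroʳ _ (q^-small (ℕₚ.≤-trans (ℕₚ.n≤1+n j) (θ-≥ α′ (suc j)))))) ⟨
    W∞ *ˢ Σ∞ (λ j → const (sgn j) *ˢ θ⁺ j) +ˢ W∞ *ˢ Σ∞ (λ j → const (sgn (suc j)) *ˢ θ⁻ (suc j))
      ≈⟨ solve 3 (λ w x y → w :* x :+ w :* y := w :* (x :+ y)) ≈-refl W∞ _ _ ⟩
    W∞ *ˢ theta ∎))
    where
    reorder : ∀ s t → s *ˢ (t *ˢ W∞) ≈ W∞ *ˢ (s *ˢ t)
    reorder s t = solve 3 (λ s t w → s :* (t :* w) := w :* (s :* t)) ≈-refl s t W∞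
    plus : ∀ j → F⁺-term N j ≈ W∞ *ˢ (const (sgn j) *ˢ θ⁺ j) [mod suc N ]
    plus j = mod-trans
      (mod-*ˢ mod-refl (mod-*ˢ mod-refl (mod-≤ (s≤s (ℕₚ.m≤m+n N j)) (W-limit (N ℕ.+ j)))))
      (mod-reflexive (reorder (const (sgn j)) (θ⁺ j)))
    U-lookup : ∀ {N j} → j ≤ N → U N j ≡ W (N ∸ j)
    U-lookup {N}     {zero}  _         = refl
    U-lookup {suc N} {suc j} (s≤s j≤N) = U-lookup j≤N
    -- `W (N ∸ j)` agrees with `W∞` only modulo `q^(N-j+1)`; the missing `j` powers of `q` are
    -- supplied by `θ⁻ j`.
    U-limit : ∀ j → θ⁻ j *ˢ U N j ≈ θ⁻ j *ˢ W∞ [mod suc N ]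
    U-limit j with ℕₚ.≤-<-connex j N
    ... | inj₂ N<j = mod-trans (q^-*-small _ (ℕₚ.≤-trans N<j (θ-≥ α′ j)))
                       (mod-sym (q^-*-small _ (ℕₚ.≤-trans N<j (θ-≥ α′ j))))
    ... | inj₁ j≤N rewrite U-lookup j≤N = mod-≤ bound (q^-*-mod (b ℕ.* tri j ℕ.+ a′ ℕ.* j) (W-limit (N ∸ j)))
      where
      bound : suc N ≤ b ℕ.* tri j ℕ.+ a′ ℕ.* j ℕ.+ suc (N ∸ j)
      bound = subst (_≤ b ℕ.* tri j ℕ.+ a′ ℕ.* j ℕ.+ suc (N ∸ j))
        (trans (ℕₚ.+-suc j (N ∸ j)) (cong suc (ℕₚ.m+[n∸m]≡n j≤N)))
        (ℕₚ.+-monoˡ-≤ (suc (N ∸ j)) (θ-≥ α′ j))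
    minus : ∀ j → F⁻-term N j ≈ W∞ *ˢ (const (sgn (suc j)) *ˢ θ⁻ (suc j)) [mod suc N ]
    minus j = mod-trans (mod-*ˢ mod-refl (U-limit (suc j)))
      (mod-reflexive (reorder (const (sgn (suc j))) (θ⁻ (suc j))))

  triple-product : theta ≈ A∞ *ˢ A′∞ *ˢ P∞
  triple-product = begin
    theta                   ≈⟨ *ˢ-identityˡ theta ⟨
    1s *ˢ theta             ≈⟨ *ˢ-cong (⁻¹-inverse P∞ (P-constant 1)) ≈-refl ⟨
    P∞ *ˢ W∞ *ˢ theta       ≈⟨ *ˢ-assoc P∞ W∞ theta ⟩
    P∞ *ˢ (W∞ *ˢ theta)     ≈⟨ *ˢ-cong ≈-refl limit ⟨
    P∞ *ˢ (A∞ *ˢ A′∞)       ≈⟨ *ˢ-comm P∞ (A∞ *ˢ A′∞) ⟩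
    A∞ *ˢ A′∞ *ˢ P∞         ∎
    where
    limit : A∞ *ˢ A′∞ ≈ W∞ *ˢ theta
    limit = mod⇒≈ (λ n → mod-≤ (ℕₚ.n≤1+n n) (mod-trans
      (mod-*ˢ mod-refl (∏∞-limit (1-q^-multipliable _ (i<1+c+b*i α′)) n))
      (mod-trans (mod-reflexive (≈-sym (F-product n))) (F-limit n))))

-- Rogers-Ramanujan and Gauss from the triple product

module ₂₃ = TripleProduct 1 2
module ₄₁ = TripleProduct 3 0
module ₁₁ = TripleProduct 0 0

-- The factors of `(q)_(5n)` sorted by residue modulo 5: the arguments of `TripleProduct` are one
-- less than the residues, so `₄₁` supplies 4 and 1, `₂₃` supplies 2, 3 and 0. The length is `n * 5`
-- because `suc n * 5` reduces to five successors.
p-block : ∀ n → p (n ℕ.* 5) ≈ (₄₁.A′ n *ˢ ₄₁.A n) *ˢ (₂₃.A n *ˢ ₂₃.A′ n *ˢ ₂₃.P n)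
p-block zero    = solve 0 (one := (one :* one) :* (one :* one :* one)) ≈-refl
  where one = con (+ 1)
p-block (suc n) = begin
  p (n ℕ.* 5) *ˢ f 1 *ˢ f 2 *ˢ f 3 *ˢ f 4 *ˢ f 5
    ≈⟨ *ˢ-cong (*ˢ-cong (*ˢ-cong (*ˢ-cong (*ˢ-cong (p-block n) (e 1)) (e 2)) (e 3)) (e 4)) (e 5) ⟩
  (₄₁.A′ n *ˢ ₄₁.A n) *ˢ (₂₃.A n *ˢ ₂₃.A′ n *ˢ ₂₃.P n) *ˢ g 1 *ˢ g 2 *ˢ g 3 *ˢ g 4 *ˢ g 5
    ≈⟨ solve 10 (λ a₁ a₄ a₂ a₃ a₅ g₁ g₂ g₃ g₄ g₅ →
         (a₁ :* a₄) :* (a₂ :* a₃ :* a₅) :* g₁ :* g₂ :* g₃ :* g₄ :* g₅ :=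
         ((a₁ :* g₁) :* (a₄ :* g₄)) :* ((a₂ :* g₂) :* (a₃ :* g₃) :* (a₅ :* g₅))) ≈-refl
       (₄₁.A′ n) (₄₁.A n) (₂₃.A n) (₂₃.A′ n) (₂₃.P n) (g 1) (g 2) (g 3) (g 4) (g 5) ⟩
  (₄₁.A′ (suc n) *ˢ ₄₁.A (suc n)) *ˢ (₂₃.A (suc n) *ˢ ₂₃.A′ (suc n) *ˢ ₂₃.P (suc n)) ∎
  where
  f g : ℕ → Series
  f i = 1s -ˢ q^ (i ℕ.+ n ℕ.* 5)
  g i = 1s -ˢ q^ (i ℕ.+ 5 ℕ.* n)
  e : ∀ i → f i ≈ g i
  e i = +ˢ-cong ≈-refl (-ˢ-cong (q^-cong (cong (i ℕ.+_) (ℕₚ.*-comm n 5))))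

mod-suc⇒≈ : ∀ {f g} → (∀ n → f ≈ g [mod suc n ]) → f ≈ g
mod-suc⇒≈ e = mod⇒≈ (λ n → mod-≤ (ℕₚ.n≤1+n n) (e n))

p∞-limit : ∀ {n m} → n ≤ m → p∞ ≈ p m [mod suc n ]
p∞-limit {n} {m} n≤m = mod-≤ (s≤s n≤m) (∏∞-limit (1-q^-multipliable suc (λ _ → ℕₚ.≤-refl)) m)

p∞-block : p∞ ≈ (₄₁.A′∞ *ˢ ₄₁.A∞) *ˢ (₂₃.A∞ *ˢ ₂₃.A′∞ *ˢ ₂₃.P∞)
p∞-block = mod-suc⇒≈ (λ n → mod-trans (p∞-limit (ℕₚ.m≤m*n n 5))
  (mod-trans (mod-reflexive (p-block n)) (mod-sym
    (mod-*ˢ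
      (mod-*ˢ (limit _ (₄₁.i<1+c+b*i 0) n) (limit _ (₄₁.i<1+c+b*i 3) n))
      (mod-*ˢ (mod-*ˢ (limit _ (₂₃.i<1+c+b*i 1) n) (limit _ (₂₃.i<1+c+b*i 2) n)) (limit _ (₂₃.i<1+c+b*i 4) n))))))
  where
  limit : ∀ (e : ℕ → ℕ) → (∀ i → i < e i) → ∀ n →
    ∏∞ (λ i → 1s -ˢ q^ (e i)) ≈ ∏ n (λ i → 1s -ˢ q^ (e i)) [mod suc n ]
  limit e i<e = ∏∞-limit (1-q^-multipliable e i<e)

-- For `k = 0` the product `pr r k` is empty, and the two terms of `1 - q^(6r+3)` are the theta
-- terms of index `r` and `-(r+1)`.
S-0 : S 0 ≈ ₂₃.theta
S-0 = ≈-trans (Σ∞-cong term) (Σ∞-+ _ _)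
  where
  eq : ∀ r x → 5 ℕ.* x ℕ.+ 2 ℕ.* r ℕ.+ (6 ℕ.* r ℕ.+ 3) ≡ 5 ℕ.* (x ℕ.+ r) ℕ.+ 3 ℕ.* suc r
  eq = solve-∀
  term : ∀ r → S-term 0 r ≈ const (sgn r) *ˢ ₂₃.θ⁺ r +ˢ const (sgn (suc r)) *ˢ ₂₃.θ⁻ (suc r)
  term r = begin
    s *ˢ (t *ˢ (1s *ˢ (1s -ˢ u)))
      ≈⟨ solve 3 (λ s t u → s :* (t :* (con (+ 1) :* (con (+ 1) :- u))) := s :* t :+ :- s :* (t :* u)) ≈-refl s t u ⟩
    s *ˢ t +ˢ -ˢ s *ˢ (t *ˢ u)
      ≈⟨ +ˢ-cong ≈-refl (*ˢ-cong (const-neg (sgn r)) (q^-split (5 ℕ.* tri r ℕ.+ 2 ℕ.* r) _ (sym (eq r (tri r))))) ⟨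
    s *ˢ t +ˢ const (sgn (suc r)) *ˢ ₂₃.θ⁻ (suc r) ∎
    where
    s = const (sgn r)
    t = ₂₃.θ⁺ r
    u = q^ (6 ℕ.* r ℕ.+ 3)

-- With `u = q^r`, the summand has the factor `(1 - uq)(1 - u⁶q⁶)`, while the theta terms of index
-- `r` and `-(r+1)` make up `1 - u²q`. The difference is `-uq(1 - u) - u⁶q⁶(1 - uq)`, whose two
-- parts cancel between neighbouring `r`; this determines `T`.
S-1 : S 1 ≈ ₄₁.theta
S-1 = begin
  S 1
    ≈⟨ ≈-trans (Σ∞-cong term) (Σ∞-+ _ _) ⟩
  Σ∞ (λ r → c r *ˢ ₄₁.θ⁺ r +ˢ c (suc r) *ˢ ₄₁.θ⁻ (suc r)) +ˢ Σ∞ (λ r → T r -ˢ T (suc r))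
    ≈⟨ +ˢ-cong (Σ∞-+ _ _) (≈-trans (Σ∞-telescope T-summable) T-zero) ⟩
  ₄₁.theta +ˢ 0s
    ≈⟨ +ˢ-identityʳ ₄₁.theta ⟩
  ₄₁.theta ∎
  where
  c : ℕ → Series
  c r = const (sgn r)
  T : ℕ → Series
  T r = -ˢ c r *ˢ (q^ (5 ℕ.* tri r ℕ.+ 4 ℕ.* r) *ˢ (q^ r *ˢ q^ 1 *ˢ (1s -ˢ q^ r)))
  T-summable : Summable T
  T-summable r = mod-*ˢ-zeroʳ _ (q^-*-small _ (₄₁.θ-≥ 3 r))
  T-zero : T 0 ≈ 0s
  T-zero = ≈-trans (*ˢ-cong ≈-refl (*ˢ-cong ≈-refl (*ˢ-cong ≈-refl (+ˢ-cong ≈-refl (-ˢ-cong q^0)))))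
    (solve 3 (λ s t u → s :* (t :* (u :* (con (+ 1) :- con (+ 1)))) := con (+ 0)) ≈-refl _ _ _)
  term : ∀ r → S-term 1 r ≈ (c r *ˢ ₄₁.θ⁺ r +ˢ c (suc r) *ˢ ₄₁.θ⁻ (suc r)) +ˢ (T r -ˢ T (suc r))
  term r = begin
    s *ˢ (q^ (S-exponent 1 r) *ˢ (1s *ˢ (1s -ˢ q^ (suc (r ℕ.+ 0))) *ˢ (1s -ˢ q^ (3 ℕ.+ 6 ℕ.* r ℕ.+ 3))))
      ≈⟨ *ˢ-cong ≈-refl (*ˢ-cong (q^-cong (e₀ r (tri r))) (*ˢ-cong (*ˢ-cong ≈-refl
           (+ˢ-cong ≈-refl (-ˢ-cong (q^-split r 1 (e₁ r))))) (+ˢ-cong ≈-refl (-ˢ-cong (q^-monomial 0 r 0 6 6 (e₂ r)))))) ⟩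
    s *ˢ (t *ˢ (1s *ˢ (1s -ˢ u *ˢ Q) *ˢ (1s -ˢ mono 6 6)))
      ≈⟨ solve 5 (λ s t u Q z →
           let one = con (+ 1)
               mono j l = z :^ 0 :* u :^ j :* Q :^ l
           in s :* (t :* (one :* (one :- u :* Q) :* (one :- mono 6 6))) :=
              (s :* t :+ :- s :* (t :* mono 2 1)) :+
              (:- s :* (t :* (u :* Q :* (one :- u))) :-
               (:- (:- s)) :* (t :* mono 5 4 :* (u :* Q :* Q :* (one :- u :* Q))))) ≈-refl s t u Q (q^ 0) ⟩
    (s *ˢ t +ˢ -ˢ s *ˢ (t *ˢ mono 2 1)) +ˢ (T r -ˢ
      (-ˢ (-ˢ s)) *ˢ (t *ˢ mono 5 4 *ˢ (u *ˢ Q *ˢ Q *ˢ (1s -ˢ u *ˢ Q))))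
      ≈⟨ +ˢ-cong
           (+ˢ-cong ≈-refl (*ˢ-cong (const-neg (sgn r))
             (≈-trans (q^-split (5 ℕ.* tri r ℕ.+ 4 ℕ.* r) _ (e₃ r (tri r))) (*ˢ-cong ≈-refl (q^-monomial 0 r 0 2 1 refl)))))
           (+ˢ-cong ≈-refl (-ˢ-cong (*ˢ-cong (-ˢ-cong (const-neg (sgn r))) (*ˢ-cong
             (≈-trans (q^-split (5 ℕ.* tri r ℕ.+ 4 ℕ.* r) _ (e₄ r (tri r))) (*ˢ-cong ≈-refl (q^-monomial 0 r 0 5 4 refl)))
             (*ˢ-cong (*ˢ-cong uQ ≈-refl) (+ˢ-cong ≈-refl (-ˢ-cong uQ))))))) ⟨
    (c r *ˢ ₄₁.θ⁺ r +ˢ c (suc r) *ˢ ₄₁.θ⁻ (suc r)) +ˢ (T r -ˢ T (suc r)) ∎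
    where
    s = c r
    t = ₄₁.θ⁺ r
    u = q^ r
    Q = q^ 1
    mono : ℕ → ℕ → Series
    mono j l = q^ 0 ^ 0 *ˢ u ^ j *ˢ Q ^ l
    uQ : q^ (suc r) ≈ u *ˢ Q
    uQ = q^-split r 1 (ℕₚ.+-comm 1 r)
    e₀ : ∀ r x → 2 ℕ.* (1 ℕ.* r) ℕ.+ (5 ℕ.* x ℕ.+ 2 ℕ.* r) ≡ 5 ℕ.* x ℕ.+ 4 ℕ.* r
    e₀ = solve-∀
    e₁ : ∀ r → suc (r ℕ.+ 0) ≡ r ℕ.+ 1
    e₁ = solve-∀
    e₂ : ∀ r → 3 ℕ.+ 6 ℕ.* r ℕ.+ 3 ≡ 0 ℕ.+ 6 ℕ.* r ℕ.+ 6
    e₂ = solve-∀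
    e₃ : ∀ r x → 5 ℕ.* (x ℕ.+ r) ℕ.+ 1 ℕ.* suc r ≡ 5 ℕ.* x ℕ.+ 4 ℕ.* r ℕ.+ (2 ℕ.* r ℕ.+ 1)
    e₃ = solve-∀
    e₄ : ∀ r x → 5 ℕ.* (x ℕ.+ r) ℕ.+ 4 ℕ.* suc r ≡ 5 ℕ.* x ℕ.+ 4 ℕ.* r ℕ.+ (5 ℕ.* r ℕ.+ 4)
    e₄ = solve-∀

-- For Rogers-Ramanujan, `x *ˢ y` is `(q)_∞` split by residues and `y` is the triple product that
-- equals `(q)_∞ G`. Cancelling `y` leaves the other two residue classes.
quotient : ∀ {x y g} → x 0 ≡ + 1 → y 0 ≡ + 1 → (x *ˢ y) *ˢ g ≈ y → x ⁻¹ ≈ g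
quotient {x} {y} {g} x₀ y₀ e = ⁻¹-unique x₀ (begin
  x *ˢ g                       ≈⟨ *ˢ-identityˡ (x *ˢ g) ⟨
  1s *ˢ (x *ˢ g)               ≈⟨ *ˢ-cong (⁻¹-inverse y y₀) ≈-refl ⟨
  y *ˢ y ⁻¹ *ˢ (x *ˢ g)        ≈⟨ solve 4 (λ y i x g → y :* i :* (x :* g) := i :* ((x :* y) :* g)) ≈-refl y (y ⁻¹) x g ⟩
  y ⁻¹ *ˢ ((x *ˢ y) *ˢ g)      ≈⟨ *ˢ-cong ≈-refl e ⟩
  y ⁻¹ *ˢ y                    ≈⟨ ≈-trans (*ˢ-comm (y ⁻¹) y) (⁻¹-inverse y y₀) ⟩
  1s                           ∎)

rogers-ramanujan-0 : (₄₁.A′∞ *ˢ ₄₁.A∞) ⁻¹ ≈ G 0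
rogers-ramanujan-0 = quotient
  (*ˢ-constant-term (₄₁.A′-constant 1) (₄₁.A-constant 1))
  (*ˢ-constant-term (*ˢ-constant-term (₂₃.A-constant 1) (₂₃.A′-constant 1)) (₂₃.P-constant 1))
  (≈-trans (*ˢ-cong (≈-sym p∞-block) ≈-refl) (≈-trans (p∞-G 0) (≈-trans S-0 ₂₃.triple-product)))

rogers-ramanujan-1 : (₂₃.A∞ *ˢ ₂₃.A′∞) ⁻¹ ≈ G 1
rogers-ramanujan-1 = quotient
  (*ˢ-constant-term (₂₃.A-constant 1) (₂₃.A′-constant 1))
  (*ˢ-constant-term (*ˢ-constant-term (₄₁.A-constant 1) (₄₁.A′-constant 1)) (₄₁.P-constant 1))
  -- `₄₁.P∞` and `₂₃.P∞` are the same product, since the base is `q^5` in both; `p∞-block` therefore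
  -- applies after a rearrangement.
  (≈-trans (*ˢ-cong (≈-trans
      (solve 5 (λ a₁ a₂ a₃ a₄ a₅ → (a₂ :* a₃) :* (a₄ :* a₁ :* a₅) := (a₁ :* a₄) :* (a₂ :* a₃ :* a₅)) ≈-refl
        ₄₁.A′∞ ₂₃.A∞ ₂₃.A′∞ ₄₁.A∞ ₄₁.P∞) (≈-sym p∞-block)) ≈-refl)
    (≈-trans (p∞-G 1) (≈-trans S-1 ₄₁.triple-product)))

p-even : ∀ n → p (n ℕ.* 2) ≈ ₁₁.A n *ˢ ₁₁.P n
p-even zero    = ≈-sym (*ˢ-identityˡ 1s)
p-even (suc n) = begin
  p (n ℕ.* 2) *ˢ f 1 *ˢ f 2
    ≈⟨ *ˢ-cong (*ˢ-cong (p-even n) (e 1)) (e 2) ⟩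
  ₁₁.A n *ˢ ₁₁.P n *ˢ g 1 *ˢ g 2
    ≈⟨ solve 4 (λ a p x y → a :* p :* x :* y := (a :* x) :* (p :* y)) ≈-refl (₁₁.A n) (₁₁.P n) (g 1) (g 2) ⟩
  ₁₁.A (suc n) *ˢ ₁₁.P (suc n) ∎
  where
  f g : ℕ → Series
  f i = 1s -ˢ q^ (i ℕ.+ n ℕ.* 2)
  g i = 1s -ˢ q^ (i ℕ.+ 2 ℕ.* n)
  e : ∀ i → f i ≈ g i
  e i = +ˢ-cong ≈-refl (-ˢ-cong (q^-cong (cong (i ℕ.+_) (ℕₚ.*-comm n 2))))

p*m : ∀ n → ₁₁.P n ≈ p n *ˢ m n
p*m zero    = ≈-sym (*ˢ-identityˡ 1s)
p*m (suc n) = begin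
  ₁₁.P n *ˢ (1s -ˢ q^ (2 ℕ.+ 2 ℕ.* n))
    ≈⟨ *ˢ-cong (p*m n) (+ˢ-cong ≈-refl (-ˢ-cong (q^-split (suc n) (suc n) (eq n)))) ⟩
  p n *ˢ m n *ˢ (1s -ˢ u *ˢ u)
    ≈⟨ solve 3 (λ p m u → p :* m :* (con (+ 1) :- u :* u) := p :* (con (+ 1) :- u) :* (m :* (con (+ 1) :+ u)))
         ≈-refl (p n) (m n) u ⟩
  p (suc n) *ˢ m (suc n) ∎
  where
  u = q^ (suc n)
  eq : ∀ n → 2 ℕ.+ 2 ℕ.* n ≡ suc n ℕ.+ suc n
  eq = solve-∀

-- With `A = (q;q²)_∞` and `P = (q²;q²)_∞`, the triple product yields `A²P`. From `AP = (q)_∞` and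
-- `P = (q)_∞ (-q)_∞` follows `A²P = A (q)_∞ = AP/(-q)_∞ = (q)_∞/(-q)_∞`.
gauss : const (+ 2) *ˢ ϑ -ˢ 1s ≈ p∞ *ˢ v∞
gauss = begin
  const (+ 2) *ˢ ϑ -ˢ 1s
    ≈⟨ solve 2 (λ t r → con (+ 2) :* t :- con (+ 1) := t :+ (t :- con (+ 1))) ≈-refl ϑ 1s ⟩
  ϑ +ˢ (ϑ -ˢ 1s)
    ≈⟨ +ˢ-cong (Σ∞-cong (λ j → *ˢ-cong ≈-refl (≈-sym (square j)))) tail-ϑ ⟩
  ₁₁.theta
    ≈⟨ ₁₁.triple-product ⟩
  ₁₁.A∞ *ˢ ₁₁.A∞ *ˢ ₁₁.P∞
    ≈⟨ solve 2 (λ a p → a :* a :* p := (a :* (a :* p)) :* con (+ 1)) ≈-refl ₁₁.A∞ ₁₁.P∞ ⟩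
  (₁₁.A∞ *ˢ (₁₁.A∞ *ˢ ₁₁.P∞)) *ˢ 1s
    ≈⟨ *ˢ-cong (*ˢ-cong ≈-refl (≈-sym even)) (≈-sym (⁻¹-inverse m∞ (m-constant 1))) ⟩
  (₁₁.A∞ *ˢ p∞) *ˢ (m∞ *ˢ v∞)
    ≈⟨ solve 4 (λ a p m v → (a :* p) :* (m :* v) := (a :* (p :* m)) :* v) ≈-refl ₁₁.A∞ p∞ m∞ v∞ ⟩
  (₁₁.A∞ *ˢ (p∞ *ˢ m∞)) *ˢ v∞
    ≈⟨ *ˢ-cong (≈-trans (*ˢ-cong ≈-refl (≈-sym pm)) (≈-sym even)) ≈-refl ⟩
  p∞ *ˢ v∞ ∎
  where
  tri-square : ∀ j → 2 ℕ.* tri j ℕ.+ 1 ℕ.* j ≡ j ℕ.* j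
  tri-square zero    = refl
  tri-square (suc j) = trans (lhs j (tri j)) (trans (cong (λ x → x ℕ.+ (2 ℕ.* j ℕ.+ 1)) (tri-square j)) (rhs j))
    where
    lhs : ∀ j x → 2 ℕ.* (x ℕ.+ j) ℕ.+ 1 ℕ.* suc j ≡ 2 ℕ.* x ℕ.+ 1 ℕ.* j ℕ.+ (2 ℕ.* j ℕ.+ 1)
    lhs = solve-∀
    rhs : ∀ j → j ℕ.* j ℕ.+ (2 ℕ.* j ℕ.+ 1) ≡ suc j ℕ.* suc j
    rhs = solve-∀
  square : ∀ j → ₁₁.θ⁺ j ≈ q^ (j ℕ.* j)
  square j = q^-cong (tri-square j)
  tail-ϑ : ϑ -ˢ 1s ≈ Σ∞ (λ j → const (sgn (suc j)) *ˢ ₁₁.θ⁻ (suc j))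
  tail-ϑ = begin
    ϑ -ˢ 1s
      ≈⟨ +ˢ-cong (Σ∞-shift ϑ-summable) ≈-refl ⟩
    (1s *ˢ q^ 0 +ˢ Σ∞ (λ j → ϑ-term (suc j))) -ˢ 1s
      ≈⟨ +ˢ-cong (+ˢ-cong (*ˢ-cong ≈-refl q^0) ≈-refl) ≈-refl ⟩
    (1s *ˢ 1s +ˢ Σ∞ (λ j → ϑ-term (suc j))) -ˢ 1s
      ≈⟨ solve 1 (λ x → (con (+ 1) :* con (+ 1) :+ x) :- con (+ 1) := x) ≈-refl _ ⟩
    Σ∞ (λ j → ϑ-term (suc j))
      ≈⟨ Σ∞-cong (λ j → *ˢ-cong ≈-refl (≈-sym (square (suc j)))) ⟩
    Σ∞ (λ j → const (sgn (suc j)) *ˢ ₁₁.θ⁻ (suc j)) ∎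
  A-limit : ∀ n → ₁₁.A∞ ≈ ₁₁.A n [mod suc n ]
  A-limit n = ∏∞-limit (1-q^-multipliable _ (₁₁.i<1+c+b*i 0)) n
  P-limit : ∀ n → ₁₁.P∞ ≈ ₁₁.P n [mod suc n ]
  P-limit n = ∏∞-limit (1-q^-multipliable _ (₁₁.i<1+c+b*i 1)) n
  even : p∞ ≈ ₁₁.A∞ *ˢ ₁₁.P∞
  even = mod-suc⇒≈ (λ n → mod-trans (p∞-limit (ℕₚ.m≤m*n n 2))
    (mod-trans (mod-reflexive (p-even n)) (mod-sym (mod-*ˢ (A-limit n) (P-limit n)))))
  pm : ₁₁.P∞ ≈ p∞ *ˢ m∞
  pm = mod-suc⇒≈ (λ n → mod-trans (P-limit n) (mod-trans (mod-reflexive (p*m n))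
    (mod-sym (mod-*ˢ (p∞-limit ℕₚ.≤-refl) (∏∞-limit 1+q^-multipliable n)))))

-- Translation to the definitions of Defs

⁻¹-cong : ∀ {f g} → f 0 ≡ + 1 → f ≈ g → f ⁻¹ ≈ g ⁻¹
⁻¹-cong {f} {g} f₀ e = ⁻¹-unique f₀
  (≈-trans (*ˢ-cong e ≈-refl) (⁻¹-inverse g (trans (sym (at e 0)) f₀)))

-- The summand of B2 with n₁ = i and n₂ = i + j.
B2-term : ℕ → ℕ → Series
B2-term i j = q^ ((i ℕ.+ j) ℕ.* (i ℕ.+ j) ℕ.+ i ℕ.* i) *ˢ (p j *ˢ m i *ˢ m i) ⁻¹

B2-constant : ∀ i j → (p j *ˢ m i *ˢ m i) 0 ≡ + 1
B2-constant i j = *ˢ-constant-term (*ˢ-constant-term (p-constant j) (m-constant i)) (m-constant i)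

B2-small : ∀ i j → B2-term i j ≈ 0s [mod i ℕ.+ j ]
B2-small i j = q^-*-small _ (ℕₚ.≤-trans (n≤n*n (i ℕ.+ j)) (ℕₚ.m≤m+n _ _))

-- Since `(i+j)² + i² = 2i² + (j² + 2ij)`, the sum over `j` for fixed `i` is `G (2i)`. This is where
-- the shape of `β` comes from.
β-0 : β 0 ≈ Σ∞ (λ i → Σ∞ (B2-term i))
β-0 = Σ∞-cong column
  where
  eq : ∀ i j → (i ℕ.+ j) ℕ.* (i ℕ.+ j) ℕ.+ i ℕ.* i ≡ 2 ℕ.* (i ℕ.* i ℕ.+ 0) ℕ.+ (j ℕ.* j ℕ.+ 2 ℕ.* i ℕ.* j)
  eq = solve-∀
  column : ∀ i → β-term 0 i ≈ Σ∞ (B2-term i)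
  column i = begin
    e *ˢ (v i *ˢ (v i *ˢ G (2 ℕ.* i)))
      ≈⟨ solve 3 (λ e x g → e :* (x :* (x :* g)) := (e :* (x :* x)) :* g) ≈-refl e (v i) (G (2 ℕ.* i)) ⟩
    (e *ˢ (v i *ˢ v i)) *ˢ G (2 ℕ.* i)
      ≈⟨ *-Σ∞ _ (G-summable (2 ℕ.* i)) ⟩
    Σ∞ (λ j → (e *ˢ (v i *ˢ v i)) *ˢ G-term (2 ℕ.* i) j)
      ≈⟨ Σ∞-cong entry ⟩
    Σ∞ (B2-term i) ∎
    where
    e = q^ (2 ℕ.* (i ℕ.* i ℕ.+ 0))
    entry : ∀ j → (e *ˢ (v i *ˢ v i)) *ˢ G-term (2 ℕ.* i) j ≈ B2-term i j
    entry j = begin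
      (e *ˢ (v i *ˢ v i)) *ˢ (q^ (j ℕ.* j ℕ.+ 2 ℕ.* i ℕ.* j) *ˢ w j)
        ≈⟨ solve 4 (λ e x f w → (e :* (x :* x)) :* (f :* w) := (e :* f) :* (w :* x :* x)) ≈-refl e (v i) _ (w j) ⟩
      (e *ˢ q^ (j ℕ.* j ℕ.+ 2 ℕ.* i ℕ.* j)) *ˢ (w j *ˢ v i *ˢ v i)
        ≈⟨ *ˢ-cong (q^-split (2 ℕ.* (i ℕ.* i ℕ.+ 0)) _ (eq i j))
             (≈-trans (⁻¹-*ˢ (*ˢ-constant-term (p-constant j) (m-constant i)) (m-constant i))
               (*ˢ-cong (⁻¹-*ˢ (p-constant j) (m-constant i)) ≈-refl)) ⟨
      B2-term i j ∎

opaque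
  unfolding q^_ Σ∞

  prodBelow-∏ : ∀ {F H} → (∀ k → F k ≈ H k) → ∀ n → prodBelow n F ≈ ∏ n H
  prodBelow-∏ e zero    = ≈-refl
  prodBelow-∏ e (suc n) = ⊛-cong (prodBelow-∏ e n) (e n)

  poch5Inf-∏ : ∀ i → poch5Inf (qpow i) ≈ ∏∞ (λ k → 1s -ˢ q^ (i ℕ.+ 5 ℕ.* k))
  poch5Inf-∏ i = coeffwise λ N → at (prodBelow-∏ (λ k →
    ⊕-cong (≈-refl {1s}) (⊝-cong (≈-sym (q^-+ i (5 ℕ.* k))))) (suc N)) N

  qs-factor : ∀ k → 1s ⊖ (qs ⊛ qpow k) ≈ 1s -ˢ q^ (suc k)
  qs-factor k = ⊕-cong (≈-refl {1s}) (⊝-cong (≈-sym (q^-suc k)))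

  -qs-factor : ∀ k → 1s ⊖ ((⊝ qs) ⊛ qpow k) ≈ 1s +ˢ q^ (suc k)
  -qs-factor k = ≈-trans
    (solve 2 (λ u t → con (+ 1) :- (:- u) :* t := con (+ 1) :+ u :* t) ≈-refl (q^ 1) (q^ k))
    (⊕-cong (≈-refl {1s}) (≈-sym (q^-suc k)))

  qPoch-p : ∀ k → qPoch k ≈ p k
  qPoch-p = prodBelow-∏ qs-factor

  mqPoch-m : ∀ k → mqPoch k ≈ m k
  mqPoch-m = prodBelow-∏ -qs-factor

  G14-∏ : G14 ≈ ₄₁.A′∞ *ˢ ₄₁.A∞
  G14-∏ = ⊛-cong (poch5Inf-∏ 1) (poch5Inf-∏ 4)

  G23-∏ : G23 ≈ ₂₃.A∞ *ˢ ₂₃.A′∞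
  G23-∏ = ⊛-cong (poch5Inf-∏ 2) (poch5Inf-∏ 3)

  inv-mqPoch : ∀ k → inv (mqPoch k) ≈ v k
  inv-mqPoch k = ⁻¹-cong (trans (at (mqPoch-m k) 0) (m-constant k)) (mqPoch-m k)

  ·-const : ∀ c {f g} → f ≈ g → c · f ≈ const c *ˢ g
  ·-const c {f} e = ≈-trans (·-scalar c f) (⊛-cong (≈-sym (const≈scalar c)) e)

  X-bridge : X ≈ Xₖ 0
  X-bridge = Σ∞-cong (λ n → ·-const (sgn n) (⊛-cong (≈-refl {qpow (n ℕ.* n)}) (inv-mqPoch (2 ℕ.* n))))

  χ-bridge : χ ≈ χₖ 0
  χ-bridge = Σ∞-cong (λ n →
    ·-const (sgn n) (⊛-cong (≈-refl {qpow (suc n ℕ.* suc n)}) (inv-mqPoch (suc (2 ℕ.* n)))))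

  -- The coefficient of `q^N` on the left involves only `i + j ≤ N`. Each row can be prolonged to
  -- `j ≤ N`, as the added terms have order above `N`.
  Σ∞-triangle : ∀ (F : ℕ → ℕ → Series) → (∀ i j → F i j ≈ 0s [mod i ℕ.+ j ]) →
    sumInf (λ n → sumSeries n (λ i → F i (n ∸ i))) ≈ Σ∞ (λ i → Σ∞ (F i))
  Σ∞-triangle F small = coeffwise λ N → trans
    (sum-triangle N (λ i j → F i j N))
    (sum-cong N (λ i i≤N → sumTo-extend (λ j → F i j N) (ℕₚ.m∸n≤m N i)
      (λ j N-i<j → get (small i j) N (subst (_< i ℕ.+ j) (ℕₚ.m+[n∸m]≡n i≤N) (ℕₚ.+-monoʳ-< i N-i<j)))))

  B2-bridge : B2 ≈ β 0
  B2-bridge = ≈-trans (≈-trans reindex (Σ∞-triangle B2-term B2-small)) (≈-sym β-0)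
    where
    summand : ∀ {n i} → i ≤ n → qpow (n ℕ.* n ℕ.+ i ℕ.* i) ⊛ inv (qPoch (n ∸ i) ⊛ mqPoch i ⊛ mqPoch i) ≈ B2-term i (n ∸ i)
    summand {n} {i} i≤n = ⊛-cong
      (q^-cong (cong (λ x → x ℕ.* x ℕ.+ i ℕ.* i) (sym (ℕₚ.m+[n∸m]≡n i≤n))))
      (≈-sym (⁻¹-cong (B2-constant i (n ∸ i))
        (≈-sym (⊛-cong (⊛-cong (qPoch-p (n ∸ i)) (mqPoch-m i)) (mqPoch-m i)))))
    reindex : B2 ≈ sumInf (λ n → sumSeries n (λ i → B2-term i (n ∸ i)))
    reindex = coeffwise λ N → sum-cong′ N (λ n → sum-cong n (λ i i≤n → at (summand i≤n) N))

  qInf-p∞ : qInf ≈ p∞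
  qInf-p∞ = coeffwise λ N → at (qPoch-p (suc N)) N

  mqInf-m∞ : mqInf ≈ m∞
  mqInf-m∞ = coeffwise λ N → at (mqPoch-m (suc N)) N

  lhs-bridge : B2 ⊕ ((+ 2) · (inv G23 ⊛ χ)) ⊖ ((+ 2) · (inv G14 ⊛ X)) ≈
    β 0 +ˢ const (+ 2) *ˢ (G 1 *ˢ χₖ 0) -ˢ const (+ 2) *ˢ (G 0 *ˢ Xₖ 0)
  lhs-bridge = ⊕-cong (⊕-cong B2-bridge
      (·-const (+ 2) (⊛-cong G23⁻¹ χ-bridge)))
      (⊝-cong (·-const (+ 2) (⊛-cong G14⁻¹ X-bridge)))
    where
    G14⁻¹ : inv G14 ≈ G 0
    -- `refl` shows that the constant term of `G14` is 1, by evaluation.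
    G14⁻¹ = ≈-trans (⁻¹-cong refl G14-∏) rogers-ramanujan-0
    G23⁻¹ : inv G23 ≈ G 1
    G23⁻¹ = ≈-trans (⁻¹-cong refl G23-∏) rogers-ramanujan-1

  rhs-bridge : ⊝ (qInf ⊛ inv (mqInf ⊛ mqInf)) ≈ -ˢ (p∞ *ˢ (v∞ *ˢ v∞))
  rhs-bridge = ⊝-cong (⊛-cong qInf-p∞ (≈-trans (⁻¹-cong refl (⊛-cong mqInf-m∞ mqInf-m∞))
    (⁻¹-*ˢ (m-constant 1) (m-constant 1))))

sealed-identity : β 0 +ˢ const (+ 2) *ˢ (G 1 *ˢ χₖ 0) -ˢ const (+ 2) *ˢ (G 0 *ˢ Xₖ 0) ≈ -ˢ (p∞ *ˢ (v∞ *ˢ v∞))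
sealed-identity = begin
  β 0 +ˢ const (+ 2) *ˢ (G 1 *ˢ χₖ 0) -ˢ const (+ 2) *ˢ (G 0 *ˢ Xₖ 0)
    ≈⟨ solve 5 (λ b g₀ g₁ x c → b :+ con (+ 2) :* (g₁ :* c) :- con (+ 2) :* (g₀ :* x) :=
         :- (con (+ 2) :* (x :* g₀ :- con (+ 1) :* c :* g₁) :- b)) ≈-refl (β 0) (G 0) (G 1) (Xₖ 0) (χₖ 0) ⟩
  -ˢ (const (+ 2) *ˢ (Xₖ 0 *ˢ G 0 -ˢ 1s *ˢ χₖ 0 *ˢ G 1) -ˢ β 0)
    ≈⟨ -ˢ-cong (+ˢ-cong (*ˢ-cong ≈-refl (+ˢ-cong ≈-refl (-ˢ-cong (*ˢ-cong (*ˢ-cong q^0 ≈-refl) ≈-refl)))) ≈-refl) ⟨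
  -ˢ (const (+ 2) *ˢ Z 0 -ˢ β 0)
    ≈⟨ -ˢ-cong main-identity ⟩
  -ˢ ((const (+ 2) *ˢ ϑ -ˢ 1s) *ˢ v∞)
    ≈⟨ -ˢ-cong (≈-trans (*ˢ-cong gauss ≈-refl) (*ˢ-assoc p∞ v∞ v∞)) ⟩
  -ˢ (p∞ *ˢ (v∞ *ˢ v∞)) ∎

theorem1p1 : (N : ℕ) → (B2 ⊕ ((+ 2) · (inv G23 ⊛ χ)) ⊖ ((+ 2) · (inv G14 ⊛ X))) N ≡ (⊝ (qInf ⊛ inv (mqInf ⊛ mqInf))) N
theorem1p1 = at (≈-trans lhs-bridge (≈-trans sealed-identity (≈-sym rhs-bridge)))
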